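{- Let $p$ be a prime, let $g\in\mathbb{Z}[X]$ be monic, and let $f(X)=g(X^p)$ be irreducible with root $\theta$. If $g(\omega(c))\equiv 0\pmod{p^2}$ for some $c\in\{0,\dots,p-1\}$, then $p\mid I(\theta)$; in particular $f$ is not monogenic.
   Context: For $c\in\mathbb{Z}$, $\omega(c)\in\mathbb{Z}/p^2\mathbb{Z}$ denotes the residue class of $c^p$ modulo $p^2$ (it depends only on $c$ modulo $p$). Let $K=\mathbb{Q}(\theta)$ with ring of integers $\mathcal{O}_K$; $I(\theta)=[\mathcal{O}_K:\mathbb{Z}[\theta]]$ denotes the index. The polynomial $f$ is called monogenic if $I(\theta)=1$, i.e. $\mathbb{Z}[\theta]=\mathcal{O}_K$. Irreducible means irreducible over $\mathbb{Q}$. -}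

module Defs where

open import Level using (Level; _⊔_; 0ℓ)
open import Algebra.Apartness.Bundles using (HeytingField; HeytingCommutativeRing)
open import Algebra.Bundles using (CommutativeRing)
open import Algebra.Bundles.Raw using (RawRing)
import Algebra.Definitions.RawSemiring as SemiringDefs
open import Data.Fin.Base using (Fin)
open import Data.Integer.Base as ℤ using (ℤ; +_)
import Data.Integer.Divisibility.Signed as ℤ
open import Data.List.Base using (List; []; _∷_; map; foldr)
open import Data.Nat.Base as ℕ using (ℕ; zero; suc)
open import Data.Product.Base using (_×_; ∃-syntax)
open import Data.Rational.Base as ℚ using (ℚ)
open import Relation.Binary.PropositionalEquality.Core using (_≡_)
open import Relation.Unary using (Pred)

private variable
  a b ℓ ℓ₁ ℓ₂ : Level

------------------------------------------------------------------------
-- Univariate polynomials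

-- Coefficient lists, constant term first. Trailing zeros are allowed, so
-- equality is equality of all coefficients rather than of lists.
module Polynomial (R : RawRing a ℓ) where
  open RawRing R

  Poly : Set a
  Poly = List Carrier

  coeff : Poly → ℕ → Carrier
  coeff []      _       = 0#
  coeff (x ∷ f) zero    = x
  coeff (x ∷ f) (suc i) = coeff f i

  _≈ₚ_ : Poly → Poly → Set ℓ
  f ≈ₚ g = ∀ i → coeff f i ≈ coeff g i

  _+ₚ_ : Poly → Poly → Poly
  []      +ₚ g       = g
  (x ∷ f) +ₚ []      = x ∷ f
  (x ∷ f) +ₚ (y ∷ g) = (x + y) ∷ (f +ₚ g)

  _*ₚ_ : Poly → Poly → Poly
  []      *ₚ g = []
  (x ∷ f) *ₚ g = map (x *_) g +ₚ (0# ∷ (f *ₚ g))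

  constant : Carrier → Poly
  constant x = x ∷ []

  X : Poly
  X = 0# ∷ 1# ∷ []

  polyRing : RawRing a ℓ
  polyRing = record
    { Carrier = Poly
    ; _≈_     = _≈ₚ_
    ; _+_     = _+ₚ_
    ; _*_     = _*ₚ_
    ; -_      = map -_
    ; 0#      = []
    ; 1#      = constant 1#
    }

  Monic : Poly → Set ℓ
  Monic f = ∃[ d ] (coeff f d ≈ 1# × (∀ i → d ℕ.< i → coeff f i ≈ 0#))

-- Value at x of the polynomial obtained by applying φ to the coefficients.
evalVia : {A : Set a} (S : RawRing b ℓ) → (A → RawRing.Carrier S) →
          List A → RawRing.Carrier S → RawRing.Carrier S
evalVia S φ f x = foldr (λ c r → φ c + x * r) 0# f
  where open RawRing S

module ℤ[X] = Polynomial ℤ.+-*-rawRing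
module ℚ[X] = Polynomial ℚ.+-*-rawRing

fromℤ : ℤ → ℚ
fromℤ z = z ℚ./ 1

-- g(X^m)
substPower : ℕ → ℤ[X].Poly → ℤ[X].Poly
substPower m g = evalVia ℤ[X].polyRing ℤ[X].constant g (ℤ[X].X ^ m)
  where open SemiringDefs (RawRing.rawSemiring ℤ[X].polyRing) using (_^_)

IrreducibleOverℚ : ℤ[X].Poly → Set
IrreducibleOverℚ f = Irreducible (map fromℤ f)
  where open SemiringDefs (RawRing.rawSemiring ℚ[X].polyRing) using (Irreducible)

------------------------------------------------------------------------
-- Residue classes

-- ℤ/mℤ, its classes given by representatives and equality being congruence.
ℤ/_ : ℕ → RawRing 0ℓ 0ℓ
ℤ/ m = record
  { Carrier = ℤ
  ; _≈_     = λ x y → + m ℤ.∣ (x ℤ.- y)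
  ; _+_     = ℤ._+_
  ; _*_     = ℤ._*_
  ; -_      = ℤ.-_
  ; 0#      = + 0
  ; 1#      = + 1
  }

ω : (p : ℕ) → ℤ → RawRing.Carrier (ℤ/ (p ℕ.^ 2))
ω p c = c ℤ.^ p

VanishesAtω : (p : ℕ) → ℤ[X].Poly → ℤ → Set
VanishesAtω p g c = evalVia (ℤ/ (p ℕ.^ 2)) (λ z → z) g (ω p c) ≈ 0#
  where open RawRing (ℤ/ (p ℕ.^ 2))

------------------------------------------------------------------------
-- The field ℚ(θ) inside an extension of ℚ

fieldRing : HeytingField a ℓ₁ ℓ₂ → RawRing a ℓ₁
fieldRing L = CommutativeRing.rawRing
  (HeytingCommutativeRing.commutativeRing (HeytingField.heytingCommutativeRing L))

-- L is a field containing ℚ through ι, and θ an element of L. The subfield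
-- ℚ(θ) and its subrings are predicates on L.
module Adjoin (L : HeytingField a ℓ₁ ℓ₂)
              (ι : ℚ → HeytingField.Carrier L)
              (θ : HeytingField.Carrier L) where
  open HeytingField L

  evalℚ : ℚ[X].Poly → Carrier → Carrier
  evalℚ = evalVia (fieldRing L) ι

  evalℤ : ℤ[X].Poly → Carrier → Carrier
  evalℤ = evalVia (fieldRing L) (λ z → ι (fromℤ z))

  IsRootOf : ℤ[X].Poly → Set ℓ₁
  IsRootOf f = evalℤ f θ ≈ 0#

  -- Quotients u(θ)/v(θ) with v(θ) nonzero.
  ℚ⟨θ⟩ : Pred Carrier (ℓ₁ ⊔ ℓ₂)
  ℚ⟨θ⟩ x = ∃[ u ] ∃[ v ] (evalℚ v θ # 0# × x * evalℚ v θ ≈ evalℚ u θ)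

  ℤ[θ] : Pred Carrier ℓ₁
  ℤ[θ] x = ∃[ h ] x ≈ evalℤ h θ

  -- The ring of integers of ℚ(θ).
  𝓞 : Pred Carrier (ℓ₁ ⊔ ℓ₂)
  𝓞 x = ℚ⟨θ⟩ x × ∃[ h ] (ℤ[X].Monic h × evalℤ h x ≈ 0#)

  -- The additive subgroup B of A has index n: there is a complete
  -- irredundant system of n representatives for the cosets of B in A.
  record HasIndex {r s} (A : Pred Carrier r) (B : Pred Carrier s) (n : ℕ)
                  : Set (a ⊔ r ⊔ s) where
    field
      rep      : Fin n → Carrier
      rep∈     : ∀ i → A (rep i)
      covers   : ∀ x → A x → ∃[ i ] B (x - rep i)
      distinct : ∀ i j → B (rep i - rep j) → i ≡ j

  -- The relation "I(θ) = n". As a relation, because computing I(θ) is not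
  -- part of its definition; n is unique when it exists.
  IndexIs : ℕ → Set (a ⊔ ℓ₁ ⊔ ℓ₂)
  IndexIs n = HasIndex 𝓞 ℤ[θ] n

  -- Monogenicity of the irreducible monic polynomial of which θ is a root.
  Monogenic : Set (a ⊔ ℓ₁ ⊔ ℓ₂)
  Monogenic = IndexIs 1

{-# OPTIONS --safe #-}

-- Let f(c) = p² a and f′(c) = p b, where p ∣ f′(c) because f = g(Xᵖ). Write
-- f = f(c) + (X − c) f₁, so that f₁(c) = f′(c), and f₁ = f₁(c) + (X − c) h.
-- Then γ = f₁(θ) / p satisfies γ² = b γ − a h(θ), so γ is integral over ℤ[θ],
-- hence over ℤ. It is not in ℤ[θ]: f₁ is monic of degree deg f − 1 and the
-- powers θⁱ with i < deg f are linearly independent. So γ has order p modulo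
-- ℤ[θ]. Translation by γ permutes the n cosets of ℤ[θ], which gives
-- n γ ∈ ℤ[θ], and therefore p ∣ n.

module Submission where

open import Defs
open import Algebra.Apartness.Bundles using (HeytingField; HeytingCommutativeRing)
open import Algebra.Bundles using (CommutativeRing)
open import Algebra.Bundles.Raw using (RawRing)
import Algebra.Definitions.RawMagma as RawMagmaDefs
import Algebra.Definitions.RawSemiring as SemiringDefs
import Algebra.Morphism.Construct.Composition as Composition
import Algebra.Morphism.Construct.Identity as Identity
open import Algebra.Morphism.Structures using (IsRingHomomorphism)
import Algebra.Properties.CommutativeSemiring.Exp as Exp
import Algebra.Properties.Group as GroupProperties
import Algebra.Properties.Monoid.Mult as Mult
import Algebra.Properties.Ring as RingProperties
import Algebra.Properties.Semiring.Sum as Sum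
import Algebra.Solver.Ring as RingSolver
open import Algebra.Solver.Ring.AlmostCommutativeRing using (fromCommutativeRing; _-Raw-AlmostCommutative⟶_)
import Algebra.Solver.Ring.NaturalCoefficients.Default as NatSolver
open import Data.Fin.Base using (Fin; zero; suc; toℕ; fromℕ; inject₁; punchOut)
open import Data.Fin.Permutation using (permutation; _⟨$⟩ʳ_)
import Data.Fin.Properties as Fin
open import Data.Integer.Base as ℤ using (ℤ; +_; -[1+_])
import Data.Integer.Divisibility.Signed as ℤ
import Data.Integer.Properties as ℤ
open import Data.Integer.Tactic.RingSolver using (solve-∀)
open import Data.List.Base using ([]; _∷_; map)
open import Data.List.Properties using (foldr-map)
open import Data.Maybe.Base as Maybe using (Maybe)
open import Data.Nat.Base as ℕ using (ℕ; zero; suc; z≤n; s≤s)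
open import Data.Nat.Coprimality using (Coprime; coprime-Bézout)
open import Data.Nat.Divisibility using (_∣_; _∣?_; ∣1⇒≡1)
open import Data.Nat.GCD using (module Bézout)
open import Data.Nat.Primality using (Prime; prime⇒irreducible; ¬prime[0]; ¬prime[1])
import Data.Nat.Properties as ℕ
open import Data.Product.Base using (_×_; ∃-syntax; Σ-syntax; _,_; proj₁; proj₂)
open import Data.Rational.Base as ℚ using (ℚ; +-*-rawRing)
import Data.Rational.Properties as ℚ
open import Data.Rational.Unnormalised.Base as ℚᵘ using (mkℚᵘ; *≡*)
import Data.Rational.Unnormalised.Properties as ℚᵘ
open import Data.Sum.Base using (inj₁; inj₂)
open import Data.Vec.Functional using (Vector; init)
open import Function.Base using (_∘_)
open import Function.Definitions using (Injective)
open import Level using (Level; _⊔_)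
import Relation.Binary.Reasoning.Setoid as SetoidReasoning
open import Relation.Binary.PropositionalEquality as ≡ using (_≡_; _≢_)
open import Relation.Nullary.Decidable using (yes; no; dec⇒maybe; decidable-stable)
open import Relation.Nullary.Negation using (¬_; contradiction)
open import Relation.Unary using (Pred)

-- The choice of γ comes from c being a double root of f modulo p: f ≡ (X - c) f₁ modulo p² and f₁ ≡
-- (X - c) h modulo p. At θ the first congruence makes (θ - c) f₁(θ) a multiple of p², so f₁(θ)² =
-- f₁(θ) (p b + (θ - c) h(θ)) can be divided by p²; this is where the square in the hypothesis is
-- spent. Translation by γ must map integers of ℚ(θ) to integers, so sums of integral elements are
-- needed besides γ itself. Both rest on transitivity of integrality, which is obtained by
-- eliminating unknowns from a linear system without division, in place of a determinant. L is an
-- abstract Heyting field in which equality is never decided, and the index is given by coset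
-- representatives. Hence no quotient group is formed: "order p" is used in the form that p γ and n
-- γ in ℤ[θ] with p and n coprime would put γ into ℤ[θ].

private variable
  a b ℓ ℓ′ ℓ₁ ℓ₂ ℓ₃ ℓ₄ : Level

-- Polynomials over a commutative ring

module PolynomialProperties (R : CommutativeRing a ℓ) where
  open CommutativeRing R
  open Polynomial rawRing public
  open SetoidReasoning setoid

  DegreeBelow : ℕ → Poly → Set ℓ
  DegreeBelow k f = ∀ i → k ℕ.≤ i → coeff f i ≈ 0#

  MonicOfDegree : ℕ → Poly → Set ℓ
  MonicOfDegree k f = coeff f k ≈ 1# × DegreeBelow (suc k) f

  coeff-+ : ∀ f g i → coeff (f +ₚ g) i ≈ coeff f i + coeff g i
  coeff-+ []      g       i       = sym (+-identityˡ _)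
  coeff-+ (x ∷ f) []      i       = sym (+-identityʳ _)
  coeff-+ (x ∷ f) (y ∷ g) zero    = refl
  coeff-+ (x ∷ f) (y ∷ g) (suc i) = coeff-+ f g i

  coeff-scale : ∀ x f i → coeff (map (x *_) f) i ≈ x * coeff f i
  coeff-scale x []      i       = sym (zeroʳ x)
  coeff-scale x (y ∷ f) zero    = refl
  coeff-scale x (y ∷ f) (suc i) = coeff-scale x f i

  degreeBelow-weaken : ∀ {j k f} → j ℕ.≤ k → DegreeBelow j f → DegreeBelow k f
  degreeBelow-weaken j≤k deg i k≤i = deg i (ℕ.≤-trans j≤k k≤i)

  degreeBelow-+ : ∀ {k} f g → DegreeBelow k f → DegreeBelow k g → DegreeBelow k (f +ₚ g)
  degreeBelow-+ f g degf degg i k≤i = begin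
    coeff (f +ₚ g) i       ≈⟨ coeff-+ f g i ⟩
    coeff f i + coeff g i  ≈⟨ +-cong (degf i k≤i) (degg i k≤i) ⟩
    0# + 0#                ≈⟨ +-identityˡ 0# ⟩
    0#                     ∎

  degreeBelow-scale : ∀ {k} x f → DegreeBelow k f → DegreeBelow k (map (x *_) f)
  degreeBelow-scale x f deg i k≤i = trans (coeff-scale x f i) (trans (*-congˡ (deg i k≤i)) (zeroʳ x))

  degreeBelow-∷ : ∀ {k} x f → DegreeBelow k f → DegreeBelow (suc k) (x ∷ f)
  degreeBelow-∷ x f deg (suc i) (s≤s k≤i) = deg i k≤i

  monic-+-degreeBelow : ∀ {k} f g → MonicOfDegree k f → DegreeBelow k g → MonicOfDegree k (f +ₚ g)
  monic-+-degreeBelow {k} f g (lead , deg) degg =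
    trans (coeff-+ f g k) (trans (+-cong lead (degg k ℕ.≤-refl)) (+-identityʳ 1#)) ,
    degreeBelow-+ f g deg (degreeBelow-weaken {f = g} (ℕ.n≤1+n k) degg)

  degreeBelow-+-monic : ∀ {k} f g → DegreeBelow k f → MonicOfDegree k g → MonicOfDegree k (f +ₚ g)
  degreeBelow-+-monic {k} f g degf (lead , deg) =
    trans (coeff-+ f g k) (trans (+-cong (degf k ℕ.≤-refl) lead) (+-identityˡ 1#)) ,
    degreeBelow-+ f g (degreeBelow-weaken {f = f} (ℕ.n≤1+n k) degf) deg

  ∷-monic : ∀ {k} x f → MonicOfDegree k f → MonicOfDegree (suc k) (x ∷ f)
  ∷-monic x f (lead , deg) = lead , degreeBelow-∷ x f deg

  zero-* : ∀ f g → f ≈ₚ [] → (f *ₚ g) ≈ₚ []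
  zero-* []      g f≈0 i = refl
  zero-* (x ∷ f) g f≈0 i = begin
    coeff (map (x *_) g +ₚ (0# ∷ (f *ₚ g))) i             ≈⟨ coeff-+ (map (x *_) g) _ i ⟩
    coeff (map (x *_) g) i + coeff (0# ∷ (f *ₚ g)) i      ≈⟨ +-cong (coeff-scale x g i) (shifted i) ⟩
    x * coeff g i + 0#                                    ≈⟨ +-identityʳ _ ⟩
    x * coeff g i                                         ≈⟨ *-congʳ (f≈0 0) ⟩
    0# * coeff g i                                        ≈⟨ zeroˡ _ ⟩
    0#                                                    ∎
    where
    shifted : ∀ i → coeff (0# ∷ (f *ₚ g)) i ≈ 0#
    shifted zero    = refl
    shifted (suc i) = zero-* f g (λ i → f≈0 (suc i)) i

  *-zero : ∀ f g → g ≈ₚ [] → (f *ₚ g) ≈ₚ []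
  *-zero []      g g≈0 i = refl
  *-zero (x ∷ f) g g≈0 i = begin
    coeff (map (x *_) g +ₚ (0# ∷ (f *ₚ g))) i             ≈⟨ coeff-+ (map (x *_) g) _ i ⟩
    coeff (map (x *_) g) i + coeff (0# ∷ (f *ₚ g)) i      ≈⟨ +-cong (degreeBelow-scale x g (λ i _ → g≈0 i) i z≤n) (shifted i) ⟩
    0# + 0#                                               ≈⟨ +-identityˡ 0# ⟩
    0#                                                    ∎
    where
    shifted : ∀ i → coeff (0# ∷ (f *ₚ g)) i ≈ 0#
    shifted zero    = refl
    shifted (suc i) = *-zero f g g≈0 i

  -- The bounds are strict: deg f ≤ j - 1 and deg g ≤ k give deg (f g) ≤ j + k - 1. The asymmetry
  -- lets the recursion run over `f` while `g` may be monic of degree k.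
  degreeBelow-* : ∀ {j k} f g → DegreeBelow j f → DegreeBelow (suc k) g → DegreeBelow (j ℕ.+ k) (f *ₚ g)
  degreeBelow-* {zero}  f       g degf degg i _ = zero-* f g (λ i → degf i z≤n) i
  degreeBelow-* {suc j} []      g degf degg i _ = refl
  degreeBelow-* {suc j} {k} (x ∷ f) g degf degg (suc i) (s≤s j+k≤i) = begin
    coeff (map (x *_) g +ₚ (0# ∷ (f *ₚ g))) (suc i)   ≈⟨ coeff-+ (map (x *_) g) _ (suc i) ⟩
    coeff (map (x *_) g) (suc i) + coeff (f *ₚ g) i   ≈⟨ +-cong (degreeBelow-scale x g degg (suc i) (s≤s (ℕ.≤-trans (ℕ.m≤n+m k j) j+k≤i)))
                                                                (degreeBelow-* {j} f g (λ i j≤i → degf (suc i) (s≤s j≤i)) degg i j+k≤i) ⟩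
    0# + 0#                                           ≈⟨ +-identityˡ 0# ⟩
    0#                                                ∎

  coeff-*-top : ∀ {j k} f g → DegreeBelow (suc j) f → MonicOfDegree k g → coeff (f *ₚ g) (j ℕ.+ k) ≈ coeff f j
  coeff-*-top {j} {k} [] g degf monic = refl
  coeff-*-top {zero} {k} (x ∷ f) g degf (lead , _) = begin
    coeff (map (x *_) g +ₚ (0# ∷ (f *ₚ g))) k             ≈⟨ coeff-+ (map (x *_) g) _ k ⟩
    coeff (map (x *_) g) k + coeff (0# ∷ (f *ₚ g)) k      ≈⟨ +-cong (trans (coeff-scale x g k) (*-congˡ lead)) (shifted k) ⟩
    x * 1# + 0#                                           ≈⟨ trans (+-identityʳ _) (*-identityʳ x) ⟩
    x                                                     ∎
    where
    shifted : ∀ i → coeff (0# ∷ (f *ₚ g)) i ≈ 0#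
    shifted zero    = refl
    shifted (suc i) = zero-* f g (λ i → degf (suc i) (s≤s z≤n)) i
  coeff-*-top {suc j} {k} (x ∷ f) g degf monic@(_ , deg) = begin
    coeff (map (x *_) g +ₚ (0# ∷ (f *ₚ g))) (suc (j ℕ.+ k))        ≈⟨ coeff-+ (map (x *_) g) _ (suc (j ℕ.+ k)) ⟩
    coeff (map (x *_) g) (suc (j ℕ.+ k)) + coeff (f *ₚ g) (j ℕ.+ k) ≈⟨ +-cong (degreeBelow-scale x g deg _ (s≤s (ℕ.m≤n+m k j)))
                                                                             (coeff-*-top {j} f g (λ i j<i → degf (suc i) (s≤s j<i)) monic) ⟩
    0# + coeff f j                                                 ≈⟨ +-identityˡ _ ⟩
    coeff f j                                                      ∎

  monic-* : ∀ {j k} f g → MonicOfDegree j f → MonicOfDegree k g → MonicOfDegree (j ℕ.+ k) (f *ₚ g)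
  monic-* {j} {k} f g (leadf , degf) monicg@(_ , degg) =
    trans (coeff-*-top {j} f g degf monicg) leadf , degreeBelow-* {suc j} f g degf degg

  -- A leading coefficient 1 in `g` cannot annihilate the leading coefficient of `f`, so degrees add
  -- without any assumption on zero divisors. For j = 0 the tail is shown to vanish first; the
  -- constant term is then the top coefficient of the product.
  cancel-degreeBelow : ∀ {j k} f g → MonicOfDegree k g → DegreeBelow (j ℕ.+ k) (f *ₚ g) → DegreeBelow j f
  cancel-degreeBelow [] g monic deg i _ = refl
  cancel-degreeBelow {suc j} {k} (x ∷ f) g monic@(_ , degg) deg (suc i) (s≤s j≤i) =
    cancel-degreeBelow {j} f g monic tail-deg i j≤i
    where
    tail-deg : DegreeBelow (j ℕ.+ k) (f *ₚ g)
    tail-deg i j+k≤i = begin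
      coeff (f *ₚ g) i                                 ≈⟨ +-identityˡ _ ⟨
      0# + coeff (f *ₚ g) i                            ≈⟨ +-congʳ (degreeBelow-scale x g degg (suc i) (s≤s (ℕ.≤-trans (ℕ.m≤n+m k j) j+k≤i))) ⟨
      coeff (map (x *_) g) (suc i) + coeff (f *ₚ g) i  ≈⟨ coeff-+ (map (x *_) g) _ (suc i) ⟨
      coeff ((x ∷ f) *ₚ g) (suc i)                     ≈⟨ deg (suc i) (s≤s j+k≤i) ⟩
      0#                                               ∎
  cancel-degreeBelow {zero} {k} (x ∷ f) g monic@(lead , degg) deg = vanish
    where
    tail-deg : DegreeBelow k (f *ₚ g)
    tail-deg i k≤i = begin
      coeff (f *ₚ g) i                                 ≈⟨ +-identityˡ _ ⟨
      0# + coeff (f *ₚ g) i                            ≈⟨ +-congʳ (degreeBelow-scale x g degg (suc i) (s≤s k≤i)) ⟨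
      coeff (map (x *_) g) (suc i) + coeff (f *ₚ g) i  ≈⟨ coeff-+ (map (x *_) g) _ (suc i) ⟨
      coeff ((x ∷ f) *ₚ g) (suc i)                     ≈⟨ deg (suc i) (ℕ.≤-trans k≤i (ℕ.n≤1+n i)) ⟩
      0#                                               ∎
    f≈0 : DegreeBelow 0 f
    f≈0 = cancel-degreeBelow {0} f g monic tail-deg
    vanish : DegreeBelow 0 (x ∷ f)
    vanish zero    _ = begin
      x                       ≈⟨ coeff-*-top {0} (x ∷ f) g (degreeBelow-∷ x f f≈0) monic ⟨
      coeff ((x ∷ f) *ₚ g) k  ≈⟨ deg k ℕ.≤-refl ⟩
      0#                      ∎
    vanish (suc i) _ = f≈0 i z≤n

  remainder-step : ∀ {m} x f g → MonicOfDegree m g → DegreeBelow m f →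
                   DegreeBelow m ((x ∷ f) +ₚ map (- coeff (x ∷ f) m *_) g)
  remainder-step {m} x f g (lead , deg) degf i m≤i with ℕ.m≤n⇒m<n∨m≡n m≤i
  ... | inj₁ m<i = degreeBelow-+ (x ∷ f) (map (_ *_) g) (degreeBelow-∷ x f degf) (degreeBelow-scale _ g deg) i m<i
  ... | inj₂ ≡.refl = begin
    coeff ((x ∷ f) +ₚ map (- t *_) g) m      ≈⟨ coeff-+ (x ∷ f) (map (- t *_) g) m ⟩
    t + coeff (map (- t *_) g) m             ≈⟨ +-congˡ (trans (coeff-scale _ g m) (trans (*-congˡ lead) (*-identityʳ _))) ⟩
    t - t                                    ≈⟨ -‿inverseʳ t ⟩
    0#                                       ∎
    where t = coeff (x ∷ f) m

  -- From f = q g + r follows x + X f = (X q) g + (x + X r). The new remainder may reach degree m,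
  -- and moving its top coefficient t times `g` into the quotient repairs this. Since `g` is monic,
  -- no coefficient is ever inverted.
  divMod : ∀ {m} g → MonicOfDegree m g → ∀ f →
           ∃[ q ] ∃[ r ] (DegreeBelow m r × f ≈ₚ ((q *ₚ g) +ₚ r))
  divMod g monic [] = [] , [] , (λ i _ → refl) , λ i → refl
  divMod {m} g monic (x ∷ f) with divMod g monic f
  ... | q , r , degr , f≈qg+r =
    t ∷ q , (x ∷ r) +ₚ map (- t *_) g , remainder-step x r g monic degr , eq
    where
    t = coeff (x ∷ r) m
    open NatSolver commutativeSemiring
    step : ∀ i → coeff (x ∷ f) i ≈ coeff (0# ∷ (q *ₚ g)) i + coeff (x ∷ r) i
    step zero    = sym (+-identityˡ x)
    step (suc i) = trans (f≈qg+r i) (coeff-+ (q *ₚ g) r i)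
    eq : ∀ i → coeff (x ∷ f) i ≈ coeff (((t ∷ q) *ₚ g) +ₚ ((x ∷ r) +ₚ map (- t *_) g)) i
    eq i = sym (begin
      coeff (((t ∷ q) *ₚ g) +ₚ ((x ∷ r) +ₚ map (- t *_) g)) i
        ≈⟨ coeff-+ ((t ∷ q) *ₚ g) _ i ⟩
      coeff ((t ∷ q) *ₚ g) i + coeff ((x ∷ r) +ₚ map (- t *_) g) i
        ≈⟨ +-cong (coeff-+ (map (t *_) g) _ i) (coeff-+ (x ∷ r) (map (- t *_) g) i) ⟩
      (coeff (map (t *_) g) i + coeff (0# ∷ (q *ₚ g)) i) + (coeff (x ∷ r) i + coeff (map (- t *_) g) i)
        ≈⟨ +-cong (+-congʳ (coeff-scale t g i)) (+-congˡ (coeff-scale (- t) g i)) ⟩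
      (t * coeff g i + coeff (0# ∷ (q *ₚ g)) i) + (coeff (x ∷ r) i + - t * coeff g i)
        ≈⟨ solve 5 (λ t u c e v → ((t :* c :+ e) :+ (v :+ u :* c)) := ((t :+ u) :* c :+ (e :+ v)))
             refl t (- t) (coeff g i) (coeff (0# ∷ (q *ₚ g)) i) (coeff (x ∷ r) i) ⟩
      (t - t) * coeff g i + (coeff (0# ∷ (q *ₚ g)) i + coeff (x ∷ r) i)
        ≈⟨ +-cong (trans (*-congʳ (-‿inverseʳ t)) (zeroˡ _)) (sym (step i)) ⟩
      0# + coeff (x ∷ f) i
        ≈⟨ +-identityˡ _ ⟩
      coeff (x ∷ f) i ∎)

-- Evaluation along a ring homomorphism

module Evaluation (R : CommutativeRing a ℓ) (S : CommutativeRing b ℓ′)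
  (φ : CommutativeRing.Carrier R → CommutativeRing.Carrier S)
  (φ-hom : IsRingHomomorphism (CommutativeRing.rawRing R) (CommutativeRing.rawRing S) φ)
  (x : CommutativeRing.Carrier S) where

  private module R = CommutativeRing R
  open CommutativeRing S
  open IsRingHomomorphism φ-hom
  open PolynomialProperties R
  open SetoidReasoning setoid
  open NatSolver commutativeSemiring

  eval : Poly → Carrier
  eval f = evalVia rawRing φ f x

  eval-zero : ∀ f → f ≈ₚ [] → eval f ≈ 0#
  eval-zero [] _ = refl
  eval-zero (c ∷ f) f≈0 = begin
    φ c + x * eval f  ≈⟨ +-cong (trans (⟦⟧-cong (f≈0 0)) 0#-homo) (*-congˡ (eval-zero f (λ i → f≈0 (suc i)))) ⟩
    0# + x * 0#       ≈⟨ trans (+-identityˡ _) (zeroʳ x) ⟩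
    0#                ∎

  eval-cong : ∀ f g → f ≈ₚ g → eval f ≈ eval g
  eval-cong []      g       f≈g = sym (eval-zero g (λ i → R.sym (f≈g i)))
  eval-cong (c ∷ f) []      f≈g = eval-zero (c ∷ f) f≈g
  eval-cong (c ∷ f) (d ∷ g) f≈g = +-cong (⟦⟧-cong (f≈g 0)) (*-congˡ (eval-cong f g (λ i → f≈g (suc i))))

  eval-+ : ∀ f g → eval (f +ₚ g) ≈ eval f + eval g
  eval-+ []      g       = sym (+-identityˡ _)
  eval-+ (c ∷ f) []      = sym (+-identityʳ _)
  eval-+ (c ∷ f) (d ∷ g) = begin
    φ (c R.+ d) + x * eval (f +ₚ g)          ≈⟨ +-cong (+-homo c d) (*-congˡ (eval-+ f g)) ⟩
    (φ c + φ d) + x * (eval f + eval g)      ≈⟨ solve 5 (λ c d x f g → (c :+ d) :+ x :* (f :+ g) := (c :+ x :* f) :+ (d :+ x :* g))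
                                                  refl (φ c) (φ d) x (eval f) (eval g) ⟩
    (φ c + x * eval f) + (φ d + x * eval g)  ∎

  eval-scale : ∀ c f → eval (map (c R.*_) f) ≈ φ c * eval f
  eval-scale c []      = sym (zeroʳ (φ c))
  eval-scale c (d ∷ f) = begin
    φ (c R.* d) + x * eval (map (c R.*_) f)  ≈⟨ +-cong (*-homo c d) (*-congˡ (eval-scale c f)) ⟩
    φ c * φ d + x * (φ c * eval f)           ≈⟨ solve 4 (λ c d x f → c :* d :+ x :* (c :* f) := c :* (d :+ x :* f)) refl (φ c) (φ d) x (eval f) ⟩
    φ c * (φ d + x * eval f)                 ∎

  eval-shift : ∀ f → eval (R.0# ∷ f) ≈ x * eval f
  eval-shift f = trans (+-congʳ 0#-homo) (+-identityˡ _)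

  eval-constant : ∀ c → eval (constant c) ≈ φ c
  eval-constant c = trans (+-congˡ (zeroʳ x)) (+-identityʳ _)

  eval-X : eval X ≈ x
  eval-X = trans (eval-shift (constant R.1#)) (trans (*-congˡ (trans (eval-constant R.1#) 1#-homo)) (*-identityʳ x))

  eval-* : ∀ f g → eval (f *ₚ g) ≈ eval f * eval g
  eval-* []      g = sym (zeroˡ _)
  eval-* (c ∷ f) g = begin
    eval (map (c R.*_) g +ₚ (R.0# ∷ (f *ₚ g)))     ≈⟨ eval-+ (map (c R.*_) g) _ ⟩
    eval (map (c R.*_) g) + eval (R.0# ∷ (f *ₚ g))  ≈⟨ +-cong (eval-scale c g) (trans (eval-shift (f *ₚ g)) (*-congˡ (eval-* f g))) ⟩
    φ c * eval g + x * (eval f * eval g)           ≈⟨ solve 4 (λ c x f g → c :* g :+ x :* (f :* g) := (c :+ x :* f) :* g) refl (φ c) x (eval f) (eval g) ⟩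
    (φ c + x * eval f) * eval g                    ∎

-- Integral elements

module IntegralElements (S : CommutativeRing a ℓ)
  (φ : ℤ → CommutativeRing.Carrier S)
  (φ-hom : IsRingHomomorphism ℤ.+-*-rawRing (CommutativeRing.rawRing S) φ) where

  open CommutativeRing S hiding (zero)
  open IsRingHomomorphism φ-hom
  open PolynomialProperties ℤ.+-*-commutativeRing
  open Evaluation ℤ.+-*-commutativeRing S φ φ-hom public
  open Exp commutativeSemiring using (_^_)
  open Sum semiring using (sum; sum-syntax; sum-cong-≋; sum-init-last; ∑-distrib-+; *-distribˡ-sum)
  open SetoidReasoning setoid

  private
    -- The solver must compare coefficients, and equality in `S` is not decidable; so they are taken
    -- in ℤ and mapped to `S` by `φ`.
    coefficients : ℤ.+-*-rawRing -Raw-AlmostCommutative⟶ fromCommutativeRing S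
    coefficients = record
      { ⟦_⟧ = φ; +-homo = +-homo; *-homo = *-homo; -‿homo = -‿homo; 0-homo = 0#-homo; 1-homo = 1#-homo }

    coefficient-≟ : ∀ m n → Maybe (φ m ≈ φ n)
    coefficient-≟ m n = Maybe.map (λ m≡n → reflexive (≡.cong φ m≡n)) (dec⇒maybe (m ℤ.≟ n))

  open RingSolver ℤ.+-*-rawRing (fromCommutativeRing S) coefficients coefficient-≟ public
    using (solve; _:=_; _:+_; _:*_; _:-_; :-_; con)

  infixl 6 _-ₚ_
  -- Written with the factor -1 so that the degree and evaluation lemmas for scaling apply.
  _-ₚ_ : Poly → Poly → Poly
  f -ₚ g = f +ₚ map (-[1+ 0 ] ℤ.*_) g

  eval-minus : ∀ z f g → eval z (f -ₚ g) ≈ eval z f - eval z g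
  eval-minus z f g = begin
    eval z (f -ₚ g)                    ≈⟨ eval-+ z f _ ⟩
    eval z f + eval z (map (-[1+ 0 ] ℤ.*_) g)  ≈⟨ +-congˡ (eval-scale z -[1+ 0 ] g) ⟩
    eval z f + φ -[1+ 0 ] * eval z g   ≈⟨ solve 2 (λ f g → f :+ con -[1+ 0 ] :* g := f :- g) refl (eval z f) (eval z g) ⟩
    eval z f - eval z g                ∎

  Integral : Carrier → Set ℓ
  Integral z = ∃[ f ] (Monic f × eval z f ≈ 0#)

  -- A system D(z) vⱼ = Σᵢ Oⱼᵢ(z) vᵢ with D monic of degree k and every Oⱼᵢ of
  -- smaller degree is the equation (D(z) I − O(z)) v = 0. Eliminating the last
  -- unknown by means of the pivot D − Oₜₜ gives a system of the same kind, of
  -- degree 2k.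
  eliminate : ∀ n {k} D (O : Fin (suc n) → Fin (suc n) → Poly) →
    MonicOfDegree k D → (∀ j i → DegreeBelow k (O j i)) →
    ∀ z (v : Vector Carrier (suc n)) →
    (∀ j → eval z D * v j ≈ ∑[ i < suc n ] (eval z (O j i) * v i)) →
    ∃[ f ] (Monic f × eval z f * v zero ≈ 0#)
  eliminate zero {k} D O monic deg z v system =
    D -ₚ O zero zero ,
    (k , monic-+-degreeBelow D (map (-[1+ 0 ] ℤ.*_) (O zero zero)) monic (degreeBelow-scale -[1+ 0 ] (O zero zero) (deg zero zero))) ,
    (begin
      eval z (D -ₚ O zero zero) * v zero                      ≈⟨ *-congʳ (eval-minus z D (O zero zero)) ⟩
      (eval z D - eval z (O zero zero)) * v zero              ≈⟨ distribʳ _ _ _ ⟩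
      eval z D * v zero + - eval z (O zero zero) * v zero     ≈⟨ +-congʳ (trans (system zero) (+-identityʳ _)) ⟩
      eval z (O zero zero) * v zero + - eval z (O zero zero) * v zero  ≈⟨ solve 2 (λ o v → o :* v :+ (:- o) :* v := con (+ 0)) refl (eval z (O zero zero)) (v zero) ⟩
      φ (+ 0)                                                 ≈⟨ 0#-homo ⟩
      0#                                                      ∎)
  eliminate (suc n) {k} D O monic deg z v system =
    eliminate n (M *ₚ D) O′ (monic-* M D M-monic monic) O′-deg z (init v) system′
    where
    t : Fin (suc (suc n))
    t = fromℕ (suc n)
    M : Poly
    M = D -ₚ O t t
    M-monic : MonicOfDegree k M
    M-monic = monic-+-degreeBelow D (map (-[1+ 0 ] ℤ.*_) (O t t)) monic (degreeBelow-scale -[1+ 0 ] (O t t) (deg t t))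
    -- Row j is multiplied by `M`, and `M` times the last unknown is replaced by the pivot row. In
    -- each product one factor has degree below k and the other at most k, so the entries stay below
    -- the degree 2k of `M *ₚ D`.
    O′ : Fin (suc n) → Fin (suc n) → Poly
    O′ j i = (O (inject₁ j) (inject₁ i) *ₚ M) +ₚ (O (inject₁ j) t *ₚ O t (inject₁ i))
    O′-deg : ∀ j i → DegreeBelow (k ℕ.+ k) (O′ j i)
    O′-deg j i = degreeBelow-+ (O (inject₁ j) (inject₁ i) *ₚ M) (O (inject₁ j) t *ₚ O t (inject₁ i))
      (degreeBelow-* {k} (O (inject₁ j) (inject₁ i)) M (deg _ _) (proj₂ M-monic))
      (degreeBelow-* {k} (O (inject₁ j) t) (O t (inject₁ i)) (deg _ _)
        (degreeBelow-weaken {f = O t (inject₁ i)} (ℕ.n≤1+n k) (deg _ _)))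
    pivot : eval z M * v t ≈ ∑[ i < suc n ] (eval z (O t (inject₁ i)) * v (inject₁ i))
    pivot = begin
      eval z M * v t                                     ≈⟨ *-congʳ (eval-minus z D (O t t)) ⟩
      (eval z D - eval z (O t t)) * v t                  ≈⟨ distribʳ _ _ _ ⟩
      eval z D * v t + - eval z (O t t) * v t            ≈⟨ +-congʳ (trans (system t) (sum-init-last (λ i → eval z (O t i) * v i))) ⟩
      (_ + eval z (O t t) * v t) + - eval z (O t t) * v t ≈⟨ solve 3 (λ s o v → (s :+ o :* v) :+ (:- o) :* v := s) refl _ (eval z (O t t)) (v t) ⟩
      _                                                  ∎
    system′ : ∀ j → eval z (M *ₚ D) * v (inject₁ j) ≈ ∑[ i < suc n ] (eval z (O′ j i) * v (inject₁ i))
    system′ j = begin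
      eval z (M *ₚ D) * v (inject₁ j)
        ≈⟨ *-congʳ (eval-* z M D) ⟩
      (m * eval z D) * v (inject₁ j)
        ≈⟨ *-assoc _ _ _ ⟩
      m * (eval z D * v (inject₁ j))
        ≈⟨ *-congˡ (trans (system (inject₁ j)) (sum-init-last (λ i → eval z (O (inject₁ j) i) * v i))) ⟩
      m * (sum row + o * v t)
        ≈⟨ solve 4 (λ m r o v → m :* (r :+ o :* v) := m :* r :+ o :* (m :* v)) refl m (sum row) o (v t) ⟩
      m * sum row + o * (m * v t)
        ≈⟨ +-cong (*-distribˡ-sum m row) (trans (*-congˡ pivot) (*-distribˡ-sum o pivotRow)) ⟩
      ∑[ i < suc n ] (m * row i) + ∑[ i < suc n ] (o * pivotRow i)
        ≈⟨ ∑-distrib-+ (λ i → m * row i) (λ i → o * pivotRow i) ⟨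
      ∑[ i < suc n ] (m * row i + o * pivotRow i)
        ≈⟨ sum-cong-≋ entry ⟩
      ∑[ i < suc n ] (eval z (O′ j i) * v (inject₁ i)) ∎
      where
      m = eval z M
      o = eval z (O (inject₁ j) t)
      row pivotRow : Vector Carrier (suc n)
      row i = eval z (O (inject₁ j) (inject₁ i)) * v (inject₁ i)
      pivotRow i = eval z (O t (inject₁ i)) * v (inject₁ i)
      entry : ∀ i → m * row i + o * pivotRow i ≈ eval z (O′ j i) * v (inject₁ i)
      entry i = begin
        m * row i + o * pivotRow i
          ≈⟨ solve 5 (λ m c o c′ v → m :* (c :* v) :+ o :* (c′ :* v) := (c :* m :+ o :* c′) :* v)
               refl m (eval z (O (inject₁ j) (inject₁ i))) o (eval z (O t (inject₁ i))) (v (inject₁ i)) ⟩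
        (eval z (O (inject₁ j) (inject₁ i)) * m + o * eval z (O t (inject₁ i))) * v (inject₁ i)
          ≈⟨ *-congʳ (+-cong (eval-* z (O (inject₁ j) (inject₁ i)) M) (eval-* z (O (inject₁ j) t) (O t (inject₁ i)))) ⟨
        (eval z (O (inject₁ j) (inject₁ i) *ₚ M) + eval z (O (inject₁ j) t *ₚ O t (inject₁ i))) * v (inject₁ i)
          ≈⟨ *-congʳ (eval-+ z (O (inject₁ j) (inject₁ i) *ₚ M) _) ⟨
        eval z (O′ j i) * v (inject₁ i) ∎

  eval-reduce : ∀ {d} y q → MonicOfDegree d q → eval y q ≈ 0# →
    ∀ f → ∃[ r ] (DegreeBelow d r × eval y f ≈ eval y r)
  eval-reduce y q monic q≈0 f with divMod q monic f
  ... | u , r , degr , f≈uq+r = r , degr , (begin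
    eval y f                          ≈⟨ eval-cong y f ((u *ₚ q) +ₚ r) f≈uq+r ⟩
    eval y ((u *ₚ q) +ₚ r)            ≈⟨ eval-+ y (u *ₚ q) r ⟩
    eval y (u *ₚ q) + eval y r        ≈⟨ +-congʳ (trans (eval-* y u q) (trans (*-congˡ q≈0) (zeroʳ _))) ⟩
    0# + eval y r                     ≈⟨ +-identityˡ _ ⟩
    eval y r                          ∎)

  eval-sum : ∀ d y f → DegreeBelow d f → eval y f ≈ ∑[ i < d ] (φ (coeff f (toℕ i)) * y ^ toℕ i)
  eval-sum zero    y f       deg = eval-zero y f (λ i → deg i z≤n)
  eval-sum (suc d) y []      deg = begin
    0#                                            ≈⟨ eval-sum d y [] (λ _ _ → ≡.refl) ⟩
    ∑[ i < d ] (φ (+ 0) * y ^ toℕ i)              ≈⟨ sum-cong-≋ {d} (λ i → trans (*-congʳ 0#-homo) (trans (zeroˡ _) (sym (trans (*-congʳ 0#-homo) (zeroˡ _))))) ⟩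
    ∑[ i < d ] (φ (+ 0) * y ^ suc (toℕ i))        ≈⟨ +-identityˡ _ ⟨
    0# + ∑[ i < d ] (φ (+ 0) * y ^ suc (toℕ i))   ≈⟨ +-congʳ (trans (*-congʳ 0#-homo) (zeroˡ _)) ⟨
    φ (+ 0) * y ^ 0 + ∑[ i < d ] (φ (+ 0) * y ^ suc (toℕ i)) ∎
  eval-sum (suc d) y (c ∷ f) deg = +-cong (sym (*-identityʳ (φ c))) (begin
    y * eval y f                                     ≈⟨ *-congˡ (eval-sum d y f (λ i d≤i → deg (suc i) (s≤s d≤i))) ⟩
    y * ∑[ i < d ] (φ (coeff f (toℕ i)) * y ^ toℕ i) ≈⟨ *-distribˡ-sum y (λ (i : Fin d) → φ (coeff f (toℕ i)) * y ^ toℕ i) ⟩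
    ∑[ i < d ] (y * (φ (coeff f (toℕ i)) * y ^ toℕ i)) ≈⟨ sum-cong-≋ {d} (λ i → solve 3 (λ y c w → y :* (c :* w) := c :* (y :* w)) refl y (φ (coeff f (toℕ i))) (y ^ toℕ i)) ⟩
    ∑[ i < d ] (φ (coeff f (toℕ i)) * y ^ suc (toℕ i)) ∎)

  module _ (y z : Carrier) where

    -- PowersBelow k e says that e = Σ_{i<k} zⁱ hᵢ(y) for some hᵢ ∈ ℤ[Y].
    data PowersBelow : ℕ → Carrier → Set (a ⊔ ℓ) where
      nil  : ∀ {e} → e ≈ 0# → PowersBelow 0 e
      cons : ∀ {k e e′} h → PowersBelow k e′ → e ≈ eval y h + z * e′ → PowersBelow (suc k) e

    powersBelow-resp : ∀ {k e e′} → e ≈ e′ → PowersBelow k e → PowersBelow k e′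
    powersBelow-resp e≈e′ (nil e≈0)     = nil (trans (sym e≈e′) e≈0)
    powersBelow-resp e≈e′ (cons h s eq) = cons h s (trans (sym e≈e′) eq)

    powersBelow-+ : ∀ {k e e′} → PowersBelow k e → PowersBelow k e′ → PowersBelow k (e + e′)
    powersBelow-+ (nil e≈0) (nil e′≈0) = nil (trans (+-cong e≈0 e′≈0) (+-identityˡ 0#))
    powersBelow-+ (cons {e′ = s} h S eq) (cons {e′ = s′} h′ S′ eq′) = cons (h +ₚ h′) (powersBelow-+ S S′)
      (trans (+-cong eq eq′) (trans
        (solve 5 (λ u s u′ s′ z → (u :+ z :* s) :+ (u′ :+ z :* s′) := (u :+ u′) :+ z :* (s :+ s′)) refl (eval y h) s (eval y h′) s′ z)
        (+-congʳ (sym (eval-+ y h h′)))))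

    powersBelow-eval* : ∀ {k e} u → PowersBelow k e → PowersBelow k (eval y u * e)
    powersBelow-eval* u (nil e≈0) = nil (trans (*-congˡ e≈0) (zeroʳ _))
    powersBelow-eval* u (cons {e′ = s} h S eq) = cons (u *ₚ h) (powersBelow-eval* u S)
      (trans (*-congˡ eq) (trans
        (solve 4 (λ u h s z → u :* (h :+ z :* s) := u :* h :+ z :* (u :* s)) refl (eval y u) (eval y h) s z)
        (+-congʳ (sym (eval-* y u h)))))

    powersBelow-neg : ∀ {k e} → PowersBelow k e → PowersBelow k (- e)
    powersBelow-neg {e = e} s = powersBelow-resp
      (trans (*-congʳ (eval-constant y -[1+ 0 ])) (solve 1 (λ e → con -[1+ 0 ] :* e := :- e) refl e))
      (powersBelow-eval* (constant -[1+ 0 ]) s)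

    powersBelow-y* : ∀ {k e} → PowersBelow k e → PowersBelow k (y * e)
    powersBelow-y* s = powersBelow-resp (*-congʳ (eval-X y)) (powersBelow-eval* X s)

    powersBelow-z* : ∀ {k e} → PowersBelow k e → PowersBelow (suc k) (z * e)
    powersBelow-z* s = cons [] s (sym (+-identityˡ _))

    powersBelow-eval : ∀ k u → PowersBelow (suc k) (eval y u)
    powersBelow-0 : ∀ k → PowersBelow k 0#
    powersBelow-0 zero    = nil refl
    powersBelow-0 (suc k) = powersBelow-eval k []
    powersBelow-eval k u = cons u (powersBelow-0 k) (sym (trans (+-congˡ (zeroʳ z)) (+-identityʳ _)))

    powersBelow-suc : ∀ {k e} → PowersBelow k e → PowersBelow (suc k) e
    powersBelow-suc (nil e≈0)     = powersBelow-resp (sym e≈0) (powersBelow-0 1)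
    powersBelow-suc (cons h s eq) = cons h (powersBelow-suc s) eq

    powersBelow-z^ : ∀ k → PowersBelow (suc k) (z ^ k)
    powersBelow-z^ zero    = powersBelow-resp (trans (eval-constant y (+ 1)) 1#-homo) (powersBelow-eval 0 (constant (+ 1)))
    powersBelow-z^ (suc k) = powersBelow-z* (powersBelow-z^ k)

    -- In Σ zⁱ hᵢ(y) each hᵢ is reduced modulo `q` to degree below d. Regrouping by powers of y then
    -- leaves coefficients that are polynomials in z of degree below k.
    coordinates : ∀ {d k} q → MonicOfDegree d q → eval y q ≈ 0# → ∀ {e} → PowersBelow k e →
      Σ[ w ∈ (Fin d → Poly) ] ((∀ i → DegreeBelow k (w i)) × e ≈ ∑[ i < d ] (eval z (w i) * y ^ toℕ i))
    coordinates {d} q monic q≈0 {e} (nil e≈0) = (λ _ → []) , (λ _ _ _ → ≡.refl) , (begin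
      e                                 ≈⟨ e≈0 ⟩
      0#                                ≈⟨ eval-sum d y [] (λ _ _ → ≡.refl) ⟩
      ∑[ i < d ] (φ (+ 0) * y ^ toℕ i)  ≈⟨ sum-cong-≋ {d} (λ i → *-congʳ 0#-homo) ⟩
      ∑[ i < d ] (0# * y ^ toℕ i)       ∎)
    coordinates {d} {suc k} q monic q≈0 {e} (cons {e′ = s} h S eq)
      with coordinates q monic q≈0 S | eval-reduce y q monic q≈0 h
    ... | w , w-deg , s≈ | r , r-deg , h≈r =
      (λ i → coeff r (toℕ i) ∷ w i) , (λ i → degreeBelow-∷ _ (w i) (w-deg i)) , (begin
        e
          ≈⟨ eq ⟩
        eval y h + z * s
          ≈⟨ +-cong (trans h≈r (eval-sum d y r r-deg)) (trans (*-congˡ s≈) (*-distribˡ-sum z (λ (i : Fin d) → eval z (w i) * y ^ toℕ i))) ⟩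
        ∑[ i < d ] (φ (coeff r (toℕ i)) * y ^ toℕ i) + ∑[ i < d ] (z * (eval z (w i) * y ^ toℕ i))
          ≈⟨ ∑-distrib-+ {d} _ _ ⟨
        ∑[ i < d ] (φ (coeff r (toℕ i)) * y ^ toℕ i + z * (eval z (w i) * y ^ toℕ i))
          ≈⟨ sum-cong-≋ {d} (λ i → solve 4 (λ c p z w → c :* p :+ z :* (w :* p) := (c :+ z :* w) :* p) refl
               (φ (coeff r (toℕ i))) (y ^ toℕ i) z (eval z (w i))) ⟩
        ∑[ i < d ] ((φ (coeff r (toℕ i)) + z * eval z (w i)) * y ^ toℕ i) ∎)

    powersBelow-y^* : ∀ {k e} j → PowersBelow k e → PowersBelow k (e * y ^ j)
    powersBelow-y^* zero    s = powersBelow-resp (sym (*-identityʳ _)) s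
    powersBelow-y^* {e = e} (suc j) s = powersBelow-resp
      (solve 3 (λ y e w → y :* (e :* w) := e :* (y :* w)) refl y e (y ^ j))
      (powersBelow-y* (powersBelow-y^* j s))

  monomial : ℕ → Poly
  monomial zero    = constant (+ 1)
  monomial (suc k) = + 0 ∷ monomial k

  monomial-monic : ∀ k → MonicOfDegree k (monomial k)
  monomial-monic zero    = ≡.refl , λ { (suc i) _ → ≡.refl }
  monomial-monic (suc k) = ∷-monic _ (monomial k) (monomial-monic k)

  eval-monomial : ∀ z k → eval z (monomial k) ≈ z ^ k
  eval-monomial z zero    = trans (eval-constant z (+ 1)) 1#-homo
  eval-monomial z (suc k) = trans (eval-shift z (monomial k)) (*-congˡ (eval-monomial z k))

  -- Multiplying the equation for zᵏ by yʲ and taking coordinates gives zᵏ yʲ = Σᵢ wⱼᵢ(z) yⁱ with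
  -- deg wⱼᵢ < k, which is a system for `eliminate` with D = Zᵏ and unknowns 1, y, ..., y^d. The
  -- surviving unknown is y⁰ = 1, so the resulting polynomial vanishes at z.
  integral-trans : ∀ {y z} k → Integral y → PowersBelow y z k (z ^ k) → Integral z
  -- A monic equation of degree 0 says 1 = 0, so the constant 1 already vanishes at z. The system
  -- below needs at least one unknown.
  integral-trans {y} {z} k (q , (zero , monic) , q≈0) s = constant (+ 1) , (0 , monomial-monic 0) , (begin
    eval z (constant (+ 1))  ≈⟨ trans (eval-constant z (+ 1)) 1#-homo ⟩
    1#                       ≈⟨ 1#-homo ⟨
    φ (+ 1)                  ≈⟨ eval-constant y (+ 1) ⟨
    eval y (constant (+ 1))  ≈⟨ eval-cong y (constant (+ 1)) q (λ { zero → ≡.sym (proj₁ monic) ; (suc i) → ≡.sym (proj₂ monic (suc i) (s≤s z≤n)) }) ⟩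
    eval y q                 ≈⟨ q≈0 ⟩
    0#                       ∎)
  integral-trans {y} {z} k (q , (suc d , monic) , q≈0) s
    with eliminate d (monomial k) (λ j → proj₁ (row j)) (monomial-monic k) (λ j → proj₁ (proj₂ (row j))) z
           (λ i → y ^ toℕ i) (λ j → trans (*-congʳ (eval-monomial z k)) (proj₂ (proj₂ (row j))))
    where
    row : ∀ (j : Fin (suc d)) → Σ[ w ∈ (Fin (suc d) → Poly) ] ((∀ i → DegreeBelow k (w i)) × z ^ k * y ^ toℕ j ≈ ∑[ i < suc d ] (eval z (w i) * y ^ toℕ i))
    row j = coordinates y z q monic q≈0 (powersBelow-y^* y z (toℕ j) s)
  ... | f , f-monic , f≈0 = f , f-monic , trans (sym (*-identityʳ _)) f≈0

  -- With z = x + y the equation f(x) = 0 reads f(z - y) = 0. Expanded in powers of z it is monic of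
  -- degree m over ℤ[y], so z is integral over ℤ[y] and transitivity applies.
  integral-+ : ∀ {x y} → Integral x → Integral y → Integral (x + y)
  integral-+ {x} {y} (f , (m , f-monic) , f≈0) y-int with expand m f f-monic
    where
    z = x + y
    expand : ∀ m f → MonicOfDegree m f → ∃[ s ] (PowersBelow y z m s × eval x f ≈ z ^ m + s)
    expand zero f (lead , deg) = 0# , nil refl , (begin
      eval x f                   ≈⟨ eval-cong x f (constant (+ 1)) (λ { zero → lead ; (suc i) → deg (suc i) (s≤s z≤n) }) ⟩
      eval x (constant (+ 1))    ≈⟨ trans (eval-constant x (+ 1)) 1#-homo ⟩
      1#                         ≈⟨ +-identityʳ 1# ⟨
      1# + 0#                    ∎)
    expand (suc m) (c ∷ f) (lead , deg) with expand m f (lead , λ i m<i → deg (suc i) (s≤s m<i))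
    ... | s , S , f≈ =
      _ , powersBelow-+ y z (powersBelow-+ y z (powersBelow-eval y z m (constant c)) (powersBelow-z* y z S))
            (powersBelow-neg y z (powersBelow-y* y z (powersBelow-+ y z (powersBelow-z^ y z m) (powersBelow-suc y z S)))) ,
      (begin
        φ c + x * eval x f
          ≈⟨ +-cong (sym (eval-constant y c)) (*-congˡ f≈) ⟩
        eval y (constant c) + x * (z ^ m + s)
          ≈⟨ solve 5 (λ c x y w s → c :+ x :* (w :+ s) := (x :+ y) :* w :+ ((c :+ (x :+ y) :* s) :+ (:- (y :* (w :+ s)))))
               refl (eval y (constant c)) x y (z ^ m) s ⟩
        z ^ suc m + ((eval y (constant c) + z * s) + - (y * (z ^ m + s))) ∎)
  ... | s , S , f≈ = integral-trans m y-int (powersBelow-resp y (x + y) -s≈z^m (powersBelow-neg y (x + y) S))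
    where
    -s≈z^m : - s ≈ (x + y) ^ m
    -s≈z^m = begin
      - s                        ≈⟨ +-identityˡ _ ⟨
      0# + - s                   ≈⟨ +-congʳ (trans (sym f≈0) f≈) ⟩
      ((x + y) ^ m + s) + - s    ≈⟨ solve 2 (λ w s → (w :+ s) :+ (:- s) := w) refl ((x + y) ^ m) s ⟩
      (x + y) ^ m                ∎

open ≡ using (refl; sym; trans; cong; cong₂; subst)

-- Roots of irreducible polynomials

module ℚPoly = PolynomialProperties ℚ.+-*-commutativeRing

module _ (S : CommutativeRing a ℓ)
  (ι : ℚ → CommutativeRing.Carrier S)
  (ι-hom : IsRingHomomorphism ℚ.+-*-rawRing (CommutativeRing.rawRing S) ι)
  (θ : CommutativeRing.Carrier S) where

  private module S = CommutativeRing S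
  open S using (_≈_; _+_; _*_; 0#; 1#)
  open Evaluation ℚ.+-*-commutativeRing S ι ι-hom θ
  open IsRingHomomorphism ι-hom using (1#-homo)
  open ℚPoly
  open SetoidReasoning S.setoid
  open SemiringDefs (RawRing.rawSemiring ℚ[X].polyRing) using (Irreducible; mkIrred)

  module _ (1≉0 : ¬ (1# ≈ 0#)) {d} f (monic : MonicOfDegree d f) (irreducible : Irreducible f) (f≈0 : eval f ≈ 0#) where

    -- The remainder of `f` modulo `r` vanishes at θ and has smaller degree than `r`, so the
    -- minimality of `r` forces it to be zero.
    minimal-divides : ∀ {n} r → MonicOfDegree n r → eval r ≈ 0# →
      (∀ s → DegreeBelow n s → eval s ≈ 0# → s ≈ₚ []) → ∃[ q ] f ≈ₚ (q *ₚ r)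
    minimal-divides {n} r r-monic r≈0 independent with divMod r r-monic f
    ... | q , s , s-deg , f≈qr+s = q , f≈qr
      where
      s≈0 : s ≈ₚ []
      s≈0 = independent s s-deg (begin
        eval s                       ≈⟨ S.+-identityˡ _ ⟨
        0# + eval s                  ≈⟨ S.+-congʳ (S.trans (eval-* q r) (S.trans (S.*-congˡ r≈0) (S.zeroʳ _))) ⟨
        eval (q *ₚ r) + eval s       ≈⟨ eval-+ (q *ₚ r) s ⟨
        eval ((q *ₚ r) +ₚ s)         ≈⟨ eval-cong f ((q *ₚ r) +ₚ s) f≈qr+s ⟨
        eval f                       ≈⟨ f≈0 ⟩
        0#                           ∎)
      f≈qr : f ≈ₚ (q *ₚ r)
      f≈qr i = trans (f≈qr+s i) (trans (coeff-+ (q *ₚ r) s i) (trans (cong (coeff (q *ₚ r) i ℚ.+_) (s≈0 i)) (ℚ.+-identityʳ _)))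

    -- Irreducibility makes one factor a unit. A unit `r` would give 1 = y(θ) r(θ) = 0. The other
    -- factor is monic of positive degree d - n, and no multiple of such a polynomial equals 1.
    no-proper-divisor : ∀ {n} q r → n ℕ.< d → MonicOfDegree n r → eval r ≈ 0# → ¬ (f ≈ₚ (q *ₚ r))
    no-proper-divisor {n} q r n<d r-monic r≈0 f≈qr with Irreducible.split-∣1 irreducible f≈qr
    ... | inj₂ (RawMagmaDefs._,_ y yr≈1) = 1≉0 (begin
      1#                        ≈⟨ 1#-homo ⟨
      ι ℚ.1ℚ                    ≈⟨ eval-constant ℚ.1ℚ ⟨
      eval (constant ℚ.1ℚ)      ≈⟨ eval-cong (y *ₚ r) (constant ℚ.1ℚ) yr≈1 ⟨
      eval (y *ₚ r)             ≈⟨ eval-* y r ⟩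
      eval y * eval r           ≈⟨ S.trans (S.*-congˡ r≈0) (S.zeroʳ _) ⟩
      0#                        ∎)
    ... | inj₁ (RawMagmaDefs._,_ y yq≈1) = contradiction (trans (sym (yq≈1 0)) (zero-* y q y≈0 0)) λ ()
      where
      -- Chosen so that deg q = d - n is visibly a successor, `suc e`.
      e = d ℕ.∸ suc n
      d≡ : suc e ℕ.+ n ≡ d
      d≡ = trans (sym (ℕ.+-suc e n)) (ℕ.m∸n+n≡m n<d)
      q-deg : DegreeBelow (suc (suc e)) q
      q-deg = cancel-degreeBelow {suc (suc e)} q r r-monic λ i d<i →
        trans (sym (f≈qr i)) (proj₂ monic i (≡.subst (ℕ._≤ i) (cong suc d≡) d<i))
      q-monic : MonicOfDegree (suc e) q
      q-monic = trans (sym (coeff-*-top {suc e} q r q-deg r-monic))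
        (trans (cong (coeff (q *ₚ r)) d≡) (trans (sym (f≈qr d)) (proj₁ monic))) , q-deg
      y≈0 : y ≈ₚ []
      y≈0 i = cancel-degreeBelow {0} y q q-monic (λ { (suc i) _ → yq≈1 (suc i) }) i z≤n

    -- Induction on the degree bound. If the top coefficient is zero, the bound drops; otherwise `r`
    -- is made monic, and the induction hypothesis says that nothing nonzero of smaller degree
    -- vanishes at θ. So `r` would be a proper divisor of `f`. The case split decides equality in ℚ
    -- only.
    powers-independent : ∀ n r → n ℕ.≤ d → DegreeBelow n r → eval r ≈ 0# → r ≈ₚ []
    powers-independent zero r n≤d deg r≈0 i = deg i z≤n
    powers-independent (suc n) r n<d deg r≈0 with coeff r n ℚ.≟ ℚ.0ℚ
    ... | yes t≡0 = powers-independent n r (ℕ.<⇒≤ n<d) deg′ r≈0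
      where
      deg′ : DegreeBelow n r
      deg′ i n≤i with ℕ.m≤n⇒m<n∨m≡n n≤i
      ... | inj₁ n<i  = deg i n<i
      ... | inj₂ refl = t≡0
    ... | no t≢0 = contradiction (proj₂ factorisation) (no-proper-divisor (proj₁ factorisation) r′ n<d r′-monic r′≈0)
      where
      instance _ = ℚ.≢-nonZero t≢0
      t⁻¹ = ℚ.1/ coeff r n
      r′ = map (t⁻¹ ℚ.*_) r
      r′-monic : MonicOfDegree n r′
      r′-monic = trans (coeff-scale t⁻¹ r n) (ℚ.*-inverseˡ (coeff r n)) , degreeBelow-scale t⁻¹ r deg
      r′≈0 : eval r′ ≈ 0#
      r′≈0 = S.trans (eval-scale t⁻¹ r) (S.trans (S.*-congˡ r≈0) (S.zeroʳ _))
      factorisation = minimal-divides r′ r′-monic r′≈0 (λ s → powers-independent n s (ℕ.<⇒≤ n<d))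

-- Synthetic division and derivatives

open PolynomialProperties ℤ.+-*-commutativeRing
open SemiringDefs (RawRing.rawSemiring ℤ[X].polyRing) using (_^_)

private module ℤEval = Evaluation ℤ.+-*-commutativeRing ℤ.+-*-commutativeRing (λ z → z)
                         (Identity.isRingHomomorphism ℤ.+-*-rawRing refl)

value : ℤ → Poly → ℤ
value = ℤEval.eval

-- The quotient of f by X − c, by Horner's scheme.
quotient : ℤ → Poly → Poly
quotient c []      = []
quotient c (x ∷ f) = value c f ∷ quotient c f

-- f = f(c) + (X − c) q gives f′(c) = q(c).
derivative : ℤ → Poly → ℤ
derivative c f = value c (quotient c f)

module _ (S : CommutativeRing a ℓ)
  (φ : ℤ → CommutativeRing.Carrier S)
  (φ-hom : IsRingHomomorphism ℤ.+-*-rawRing (CommutativeRing.rawRing S) φ) where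

  private module S = CommutativeRing S
  open S using (_≈_; _+_; _*_; _-_)
  open IsRingHomomorphism φ-hom
  open IntegralElements S φ φ-hom using (solve; _:=_; _:+_; _:*_; _:-_; con)
  open Evaluation ℤ.+-*-commutativeRing S φ φ-hom using (eval)
  open SetoidReasoning S.setoid

  eval-quotient : ∀ x c f → eval x f ≈ φ (value c f) + (x - φ c) * eval x (quotient c f)
  eval-quotient x c [] = S.sym (S.trans (S.+-cong 0#-homo (S.zeroʳ _)) (S.+-identityˡ _))
  eval-quotient x c (y ∷ f) = begin
    φ y + x * eval x f
      ≈⟨ S.+-congˡ (S.*-congˡ (eval-quotient x c f)) ⟩
    φ y + x * (φ e + (x - φ c) * q)
      ≈⟨ solve 5 (λ y x e c q → y :+ x :* (e :+ (x :- c) :* q) := (y :+ c :* e) :+ (x :- c) :* (e :+ x :* q))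
           S.refl (φ y) x (φ e) (φ c) q ⟩
    (φ y + φ c * φ e) + (x - φ c) * (φ e + x * q)
      ≈⟨ S.+-congʳ (S.trans (+-homo y (c ℤ.* e)) (S.+-congˡ (*-homo c e))) ⟨
    φ (y ℤ.+ c ℤ.* e) + (x - φ c) * (φ e + x * q) ∎
    where
    e = value c f
    q = eval x (quotient c f)

quotient-degreeBelow : ∀ {k} c f → DegreeBelow (suc k) f → DegreeBelow k (quotient c f)
quotient-degreeBelow c [] deg i _ = refl
quotient-degreeBelow {zero} c (x ∷ f) deg zero _ = ℤEval.eval-zero c f (λ i → deg (suc i) (s≤s z≤n))
quotient-degreeBelow {zero} c (x ∷ f) deg (suc i) _ =
  quotient-degreeBelow c f (λ i _ → deg (suc i) (s≤s z≤n)) i z≤n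
quotient-degreeBelow {suc k} c (x ∷ f) deg =
  degreeBelow-∷ (value c f) (quotient c f) (quotient-degreeBelow c f (λ i k<i → deg (suc i) (s≤s k<i)))

quotient-monic : ∀ {d} c f → MonicOfDegree (suc d) f → MonicOfDegree d (quotient c f)
quotient-monic c [] (() , _)
quotient-monic {zero} c (x ∷ f) (lead , deg) =
  trans (ℤEval.eval-cong c f (constant (+ 1)) (λ { zero → lead ; (suc i) → deg (suc (suc i)) (s≤s (s≤s z≤n)) }))
        (ℤEval.eval-constant c (+ 1)) ,
  degreeBelow-∷ (value c f) (quotient c f) (quotient-degreeBelow c f (λ i 1≤i → deg (suc i) (s≤s 1≤i)))
quotient-monic {suc d} c (x ∷ f) (lead , deg) =
  ∷-monic (value c f) (quotient c f) (quotient-monic c f (lead , λ i d<i → deg (suc i) (s≤s d<i)))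

module _ (c : ℤ) where
  open ≡.≡-Reasoning
  open import Data.Integer.Base using (_+_; _*_)

  derivative-+ : ∀ f g → derivative c (f +ₚ g) ≡ derivative c f + derivative c g
  derivative-+ []      g       = sym (ℤ.+-identityˡ _)
  derivative-+ (x ∷ f) []      = sym (ℤ.+-identityʳ _)
  derivative-+ (x ∷ f) (y ∷ g) = begin
    value c (f +ₚ g) + c * derivative c (f +ₚ g)
      ≡⟨ cong₂ (λ u v → u + c * v) (ℤEval.eval-+ c f g) (derivative-+ f g) ⟩
    (value c f + value c g) + c * (derivative c f + derivative c g)
      ≡⟨ rearrange (value c f) (value c g) c (derivative c f) (derivative c g) ⟩
    (value c f + c * derivative c f) + (value c g + c * derivative c g) ∎
    where
    rearrange : ∀ u v c s t → (u + v) + c * (s + t) ≡ (u + c * s) + (v + c * t)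
    rearrange = solve-∀

  derivative-scale : ∀ x f → derivative c (map (x *_) f) ≡ x * derivative c f
  derivative-scale x []      = sym (ℤ.*-zeroʳ x)
  derivative-scale x (y ∷ f) = begin
    value c (map (x *_) f) + c * derivative c (map (x *_) f)
      ≡⟨ cong₂ (λ u v → u + c * v) (ℤEval.eval-scale c x f) (derivative-scale x f) ⟩
    x * value c f + c * (x * derivative c f)
      ≡⟨ rearrange x (value c f) c (derivative c f) ⟩
    x * (value c f + c * derivative c f) ∎
    where
    rearrange : ∀ x u c s → x * u + c * (x * s) ≡ x * (u + c * s)
    rearrange = solve-∀

  derivative-* : ∀ f g → derivative c (f *ₚ g) ≡ derivative c f * value c g + value c f * derivative c g
  derivative-* []      g = refl
  derivative-* (x ∷ f) g = begin
    derivative c (map (x *_) g +ₚ (+ 0 ∷ (f *ₚ g)))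
      ≡⟨ derivative-+ (map (x *_) g) _ ⟩
    derivative c (map (x *_) g) + (value c (f *ₚ g) + c * derivative c (f *ₚ g))
      ≡⟨ cong₂ _+_ (derivative-scale x g) (cong₂ (λ u v → u + c * v) (ℤEval.eval-* c f g) (derivative-* f g)) ⟩
    x * derivative c g + (value c f * value c g + c * (derivative c f * value c g + value c f * derivative c g))
      ≡⟨ rearrange x c (value c f) (value c g) (derivative c f) (derivative c g) ⟩
    (value c f + c * derivative c f) * value c g + (x + c * value c f) * derivative c g ∎
    where
    rearrange : ∀ x c u v s t → x * t + (u * v + c * (s * v + u * t)) ≡ (u + c * s) * v + (x + c * u) * t
    rearrange = solve-∀

  value-X^ : ∀ n → value c (X ^ n) ≡ c ℤ.^ n
  value-X^ zero    = ℤEval.eval-constant c (+ 1)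
  value-X^ (suc n) = trans (ℤEval.eval-* c X (X ^ n)) (cong₂ _*_ (ℤEval.eval-X c) (value-X^ n))

  derivative-X^ : ∀ n → derivative c (X ^ suc n) ≡ + suc n * c ℤ.^ n
  derivative-X^ n = begin
    derivative c (X *ₚ (X ^ n))                                          ≡⟨ derivative-* X (X ^ n) ⟩
    derivative c X * value c (X ^ n) + value c X * derivative c (X ^ n) ≡⟨ cong₂ (λ u v → derivative c X * u + v * derivative c (X ^ n)) (value-X^ n) (ℤEval.eval-X c) ⟩
    derivative c X * c ℤ.^ n + c * derivative c (X ^ n)                ≡⟨ step n ⟩
    + suc n * c ℤ.^ n                                                  ∎
    where
    -- The first factor is `derivative c X` unfolded; its value is 1.
    base : ∀ c → (+ 1 + c * + 0 + c * (+ 0 + c * + 0)) * + 1 + c * (+ 0 + c * + 0) ≡ + 1 * + 1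
    base = solve-∀
    rearrange : ∀ c w n → (+ 1 + c * + 0 + c * (+ 0 + c * + 0)) * (c * w) + c * (n * w) ≡ (+ 1 + n) * (c * w)
    rearrange = solve-∀
    step : ∀ n → derivative c X * c ℤ.^ n + c * derivative c (X ^ n) ≡ + suc n * c ℤ.^ n
    step zero    = base c
    step (suc n) = trans (cong (λ u → derivative c X * c ℤ.^ suc n + c * u) (derivative-X^ n)) (rearrange c (c ℤ.^ n) (+ suc n))

  -- For m = p the point cᵖ represents ω(c), so this turns the hypothesis on `g` into p² ∣ f(c).
  value-substPower : ∀ m g → value c (substPower m g) ≡ value (c ℤ.^ m) g
  value-substPower m []      = refl
  value-substPower m (x ∷ g) = begin
    value c (constant x +ₚ ((X ^ m) *ₚ substPower m g))
      ≡⟨ ℤEval.eval-+ c (constant x) ((X ^ m) *ₚ substPower m g) ⟩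
    value c (constant x) + value c ((X ^ m) *ₚ substPower m g)
      ≡⟨ cong₂ _+_ (ℤEval.eval-constant c x) (trans (ℤEval.eval-* c (X ^ m) (substPower m g)) (cong₂ _*_ (value-X^ m) (value-substPower m g))) ⟩
    x + c ℤ.^ m * value (c ℤ.^ m) g ∎

  -- The chain rule would give f′(c) = p cᵖ⁻¹ g′(cᵖ); only the factor p is tracked. In the Horner
  -- step the derivative of Xᵖ r is p cᵖ⁻¹ r(c) + cᵖ r′(c), where the first term shows the factor
  -- and the second has it by induction.
  derivative-substPower : ∀ n g → + suc n ℤ.∣ derivative c (substPower (suc n) g)
  derivative-substPower n []      = ℤ.divides (+ 0) refl
  derivative-substPower n (x ∷ g) with derivative-substPower n g
  ... | ℤ.divides q eq = ℤ.divides (c ℤ.^ n * value c r + c ℤ.^ suc n * q) (begin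
    derivative c (constant x +ₚ ((X ^ suc n) *ₚ r))
      ≡⟨ derivative-+ (constant x) ((X ^ suc n) *ₚ r) ⟩
    derivative c (constant x) + derivative c ((X ^ suc n) *ₚ r)
      ≡⟨ cong₂ _+_ (ℤEval.eval-constant c (+ 0)) (derivative-* (X ^ suc n) r) ⟩
    + 0 + (derivative c (X ^ suc n) * value c r + value c (X ^ suc n) * derivative c r)
      ≡⟨ cong₂ (λ u v → + 0 + (u * value c r + v)) (derivative-X^ n) (cong₂ _*_ (value-X^ (suc n)) eq) ⟩
    + 0 + (+ suc n * c ℤ.^ n * value c r + c ℤ.^ suc n * (q * + suc n))
      ≡⟨ rearrange (+ suc n) (c ℤ.^ n) (value c r) (c ℤ.^ suc n) q ⟩
    (c ℤ.^ n * value c r + c ℤ.^ suc n * q) * + suc n ∎)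
    where
    r = substPower (suc n) g
    rearrange : ∀ n w v w′ q → + 0 + (n * w * v + w′ * (q * n)) ≡ (w * v + w′ * q) * n
    rearrange = solve-∀

-- The degree of g(Xᵖ)

X-monic : MonicOfDegree 1 X
X-monic = refl , λ { (suc (suc i)) _ → refl ; (suc zero) (s≤s ()) }

X^-monic : ∀ n → MonicOfDegree n (X ^ n)
X^-monic zero    = refl , λ { (suc i) _ → refl }
X^-monic (suc n) = monic-* X (X ^ n) X-monic (X^-monic n)

substPower-zero : ∀ n g → g ≈ₚ [] → substPower n g ≈ₚ []
substPower-zero n []      g≈0 i = refl
substPower-zero n (x ∷ g) g≈0 i = degreeBelow-+ (constant x) ((X ^ n) *ₚ substPower n g)
  (λ { zero _ → g≈0 0 ; (suc i) _ → refl })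
  (λ i _ → *-zero (X ^ n) (substPower n g) (substPower-zero n g (λ i → g≈0 (suc i))) i) i z≤n

substPower-monic : ∀ {e} n g → MonicOfDegree e g → MonicOfDegree (e ℕ.* suc n) (substPower (suc n) g)
substPower-monic n [] (() , _)
substPower-monic {zero} n (x ∷ g) (lead , deg) =
  monic-+-degreeBelow (constant x) ((X ^ suc n) *ₚ substPower (suc n) g)
    (lead , λ { (suc i) _ → refl })
    (λ i _ → *-zero (X ^ suc n) (substPower (suc n) g) (substPower-zero (suc n) g (λ i → deg (suc i) (s≤s z≤n))) i)
substPower-monic {suc e} n (x ∷ g) (lead , deg) =
  -- The constant term lies below the leading one because the exponent `suc n` is positive.
  degreeBelow-+-monic (constant x) ((X ^ suc n) *ₚ substPower (suc n) g) (λ { zero () ; (suc i) _ → refl })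
    (monic-* (X ^ suc n) (substPower (suc n) g) (X^-monic (suc n))
      (substPower-monic n g (lead , λ i e<i → deg (suc i) (s≤s e<i))))

-- The embedding of ℤ into ℚ

-- The fraction z / 1 is brought to lowest terms, which does not compute for a variable z. The laws
-- are therefore checked on unnormalised fractions and carried back by injectivity.
fromℤ-isRingHomomorphism : IsRingHomomorphism ℤ.+-*-rawRing ℚ.+-*-rawRing fromℤ
fromℤ-isRingHomomorphism = record
  { isSemiringHomomorphism = record
    { isNearSemiringHomomorphism = record
      { +-isMonoidHomomorphism = record
        { isMagmaHomomorphism = record
          { isRelHomomorphism = record { cong = cong fromℤ }
          ; homo = +-homo
          }
        ; ε-homo = refl
        }
      ; *-homo = *-homo
      }
    ; 1#-homo = refl
    }
  ; -‿homo = neg-homo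
  }
  where
  open ℚᵘ.≃-Reasoning
  numerator : ∀ z → ℚ.toℚᵘ (fromℤ z) ℚᵘ.≃ mkℚᵘ z 0
  numerator z = ℚ.toℚᵘ-fromℚᵘ (mkℚᵘ z 0)
  +-homo : ∀ m n → fromℤ (m ℤ.+ n) ≡ fromℤ m ℚ.+ fromℤ n
  +-homo m n = ℚ.toℚᵘ-injective (begin
    ℚ.toℚᵘ (fromℤ (m ℤ.+ n))                     ≈⟨ numerator (m ℤ.+ n) ⟩
    mkℚᵘ (m ℤ.+ n) 0                             ≈⟨ *≡* (rearrange m n) ⟩
    mkℚᵘ m 0 ℚᵘ.+ mkℚᵘ n 0                       ≈⟨ ℚᵘ.+-cong (numerator m) (numerator n) ⟨
    ℚ.toℚᵘ (fromℤ m) ℚᵘ.+ ℚ.toℚᵘ (fromℤ n)       ≈⟨ ℚ.toℚᵘ-homo-+ (fromℤ m) (fromℤ n) ⟨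
    ℚ.toℚᵘ (fromℤ m ℚ.+ fromℤ n)                 ∎)
    where
    rearrange : ∀ m n → (m ℤ.+ n) ℤ.* + 1 ≡ (m ℤ.* + 1 ℤ.+ n ℤ.* + 1) ℤ.* + 1
    rearrange = solve-∀
  *-homo : ∀ m n → fromℤ (m ℤ.* n) ≡ fromℤ m ℚ.* fromℤ n
  *-homo m n = ℚ.toℚᵘ-injective (begin
    ℚ.toℚᵘ (fromℤ (m ℤ.* n))                     ≈⟨ numerator (m ℤ.* n) ⟩
    mkℚᵘ m 0 ℚᵘ.* mkℚᵘ n 0                       ≈⟨ ℚᵘ.*-cong (numerator m) (numerator n) ⟨
    ℚ.toℚᵘ (fromℤ m) ℚᵘ.* ℚ.toℚᵘ (fromℤ n)       ≈⟨ ℚ.toℚᵘ-homo-* (fromℤ m) (fromℤ n) ⟨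
    ℚ.toℚᵘ (fromℤ m ℚ.* fromℤ n)                 ∎)
  neg-homo : ∀ m → fromℤ (ℤ.- m) ≡ ℚ.- fromℤ m
  neg-homo m = ℚ.toℚᵘ-injective (begin
    ℚ.toℚᵘ (fromℤ (ℤ.- m))     ≈⟨ numerator (ℤ.- m) ⟩
    ℚᵘ.- mkℚᵘ m 0              ≈⟨ ℚᵘ.-‿cong (numerator m) ⟨
    ℚᵘ.- ℚ.toℚᵘ (fromℤ m)      ≈⟨ ℚ.toℚᵘ-homo‿- (fromℤ m) ⟨
    ℚ.toℚᵘ (ℚ.- fromℤ m)       ∎)

fromℤ-injective : ∀ {m n} → fromℤ m ≡ fromℤ n → m ≡ n
fromℤ-injective {m} {n} eq with ℚ./-injective-≃ (mkℚᵘ m 0) (mkℚᵘ n 0) eq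
... | *≡* m*1≡n*1 = ℤ.*-cancelʳ-≡ m n (+ 1) m*1≡n*1

coeff-map-fromℤ : ∀ f i → ℚPoly.coeff (map fromℤ f) i ≡ fromℤ (coeff f i)
coeff-map-fromℤ []      i       = refl
coeff-map-fromℤ (x ∷ f) zero    = refl
coeff-map-fromℤ (x ∷ f) (suc i) = coeff-map-fromℤ f i

-- The index

-- Pigeonhole: if σ omitted some j, punching j out would inject `Fin (suc n)` into `Fin n`. So every
-- j has a preimage, found by search.
injective⇒permutation : ∀ {n} (σ : Fin n → Fin n) → Injective _≡_ _≡_ σ →
  ∃[ π ] (∀ i → _⟨$⟩ʳ_ {n} {n} π i ≡ σ i)
injective⇒permutation {n} σ injective =
  permutation σ (proj₁ ∘ preimage) (proj₂ ∘ preimage) (λ i → injective (proj₂ (preimage (σ i)))) , λ _ → refl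
  where
  omits : ∀ {n} (σ : Fin n → Fin n) → Injective _≡_ _≡_ σ → ∀ j → ¬ (∀ i → j ≢ σ i)
  omits {suc n} σ injective j j∉σ =
    ℕ.1+n≰n (Fin.injective⇒≤ {f = λ i → punchOut (j∉σ i)} (λ {i} {k} → injective ∘ Fin.punchOut-injective (j∉σ i) (j∉σ k)))
  preimage : ∀ j → ∃[ i ] σ i ≡ j
  preimage j with Fin.any? (λ i → σ i Fin.≟ j)
  ... | yes found = found
  ... | no  none  = contradiction (λ i j≡σi → none (i , sym j≡σi)) (omits σ injective j)

module CosetCounting (L : HeytingField a ℓ₁ ℓ₂) (ι : ℚ → HeytingField.Carrier L) (θ : HeytingField.Carrier L)
  {A : Pred (HeytingField.Carrier L) ℓ₃} {B : Pred (HeytingField.Carrier L) ℓ₄} where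

  private
    S : CommutativeRing _ _
    S = HeytingCommutativeRing.commutativeRing (HeytingField.heytingCommutativeRing L)
  open CommutativeRing S hiding (zero; refl; sym; trans)
  private module S = CommutativeRing S
  open Adjoin L ι θ using (HasIndex)
  open Sum semiring
  open Mult +-monoid renaming (_×_ to _·_; ×-assocˡ to ·-assocˡ) using ()
  open GroupProperties +-group using (∙-cancelʳ; ⁻¹-anti-homo-∙; //-rightDividesˡ; //-rightDividesʳ)
  open SetoidReasoning setoid

  private
    -‿cancelʳ : ∀ x y z → (x + z) - (y + z) ≈ x - y
    -‿cancelʳ x y z = begin
      (x + z) - (y + z)        ≈⟨ +-congˡ (⁻¹-anti-homo-∙ y z) ⟩
      (x + z) + (- z - y)      ≈⟨ +-assoc (x + z) (- z) (- y) ⟨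
      ((x + z) - z) - y        ≈⟨ +-congʳ (//-rightDividesʳ z x) ⟩
      x - y                    ∎

  module _ (B-resp : ∀ {x y} → x ≈ y → B x → B y) (B-0 : B 0#)
           (B-+ : ∀ {x y} → B x → B y → B (x + y)) (B-neg : ∀ {x} → B x → B (- x)) where

    B-sum : ∀ {n} (t : Vector Carrier n) → (∀ i → B (t i)) → B (sum t)
    B-sum {zero}  t Bt = B-0
    B-sum {suc n} t Bt = B-+ (Bt zero) (B-sum (t ∘ suc) (Bt ∘ suc))

    B-· : ∀ n {x} → B x → B (n · x)
    B-· zero    Bx = B-0
    B-· (suc n) Bx = B-+ Bx (B-· n Bx)

    -- Translation by γ permutes the cosets, so summing rep i + γ ≡ rep (σ i) over all i cancels the representatives.
    index-· : ∀ {n γ} → HasIndex A B n → (∀ {x} → A x → A (x + γ)) → B (n · γ)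
    index-· {n} {γ} hasIndex A-+γ = B-resp total (B-sum difference (proj₂ ∘ translate))
      where
      open HasIndex hasIndex
      translate : ∀ i → ∃[ j ] B (rep i + γ - rep j)
      translate i = covers (rep i + γ) (A-+γ (rep∈ i))
      σ : Fin n → Fin n
      σ = proj₁ ∘ translate
      difference : Vector Carrier n
      difference i = rep i + γ - rep (σ i)
      -- If i and j are sent to the same coset, `rep i - rep j` is a difference of two elements of
      -- `B`, and representatives of distinct cosets exclude that unless i = j.
      σ-injective : Injective _≡_ _≡_ σ
      σ-injective {i} {j} σi≡σj = distinct i j (B-resp (begin
        difference i - difference j
          ≡⟨ cong (λ k → difference i - (rep j + γ - rep k)) (sym σi≡σj) ⟩
        (rep i + γ - rep (σ i)) - (rep j + γ - rep (σ i))
          ≈⟨ -‿cancelʳ (rep i + γ) (rep j + γ) (- rep (σ i)) ⟩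
        (rep i + γ) - (rep j + γ)
          ≈⟨ -‿cancelʳ (rep i) (rep j) γ ⟩
        rep i - rep j ∎) (B-+ (proj₂ (translate i)) (B-neg (proj₂ (translate j)))))
      total : sum difference ≈ n · γ
      total = ∙-cancelʳ (sum rep) _ _ (begin
        sum difference + sum rep
          ≈⟨ +-congˡ (sum-permute rep (proj₁ perm)) ⟩
        sum difference + sum (λ i → rep (σ i))
          ≈⟨ ∑-distrib-+ difference (rep ∘ σ) ⟨
        sum (λ i → difference i + rep (σ i))
          ≈⟨ sum-cong-≋ (λ i → //-rightDividesˡ (rep (σ i)) (rep i + γ)) ⟩
        sum (λ i → rep i + γ)
          ≈⟨ ∑-distrib-+ rep (λ _ → γ) ⟩
        sum rep + sum {n} (λ _ → γ)
          ≈⟨ S.trans (+-comm _ _) (+-congʳ (sum-replicate n)) ⟩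
        n · γ + sum rep ∎)
        where perm = injective⇒permutation σ σ-injective

    ·-consecutive : ∀ {k l x} → suc k ≡ l → B (l · x) → B (k · x) → B x
    ·-consecutive {k} {x = x} refl Bl Bk = B-resp (//-rightDividesʳ (k · x) x) (B-+ Bl (B-neg Bk))

    -- Over ℕ the Bézout identity says that some multiple of m and some multiple of n are
    -- consecutive, in one order or the other. The corresponding multiples of x lie in `B` and
    -- differ by x.
    ·-coprime : ∀ {m n x} → Coprime m n → B (m · x) → B (n · x) → B x
    ·-coprime {m} {n} {x} coprime Bmx Bnx with coprime-Bézout coprime
    ... | Bézout.+- u v eq = ·-consecutive eq (B-resp (·-assocˡ x u m) (B-· u Bmx)) (B-resp (·-assocˡ x v n) (B-· v Bnx))
    ... | Bézout.-+ u v eq = ·-consecutive eq (B-resp (·-assocˡ x v n) (B-· v Bnx)) (B-resp (·-assocˡ x u m) (B-· u Bmx))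

-- The element γ and the index of ℤ[θ]

module PowerSubstitutionRoot (L : HeytingField a ℓ₁ ℓ₂) (ι : ℚ → HeytingField.Carrier L)
  (ι-hom : IsRingHomomorphism +-*-rawRing (fieldRing L) ι) (θ : HeytingField.Carrier L) where

  private
    S : CommutativeRing _ _
    S = HeytingCommutativeRing.commutativeRing (HeytingField.heytingCommutativeRing L)
  open CommutativeRing S hiding (zero; refl; sym; trans)
  private module S = CommutativeRing S
  open HeytingField L using (_#_; #-irrefl; invertible⇒#)
  open Adjoin L ι θ
  open Mult +-monoid renaming (_×_ to _·_) using ()
  open RingProperties ring using (-0#≈0#)
  open SetoidReasoning setoid

  φ : ℤ → Carrier
  φ = ι ∘ fromℤ

  φ-hom : IsRingHomomorphism ℤ.+-*-rawRing rawRing φ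
  φ-hom = Composition.isRingHomomorphism S.trans fromℤ-isRingHomomorphism ι-hom

  open IntegralElements S φ φ-hom
  private
    module φ = IsRingHomomorphism φ-hom
    module ι = IsRingHomomorphism ι-hom
    module ℚEval = Evaluation ℚ.+-*-commutativeRing S ι ι-hom θ

  1#0 : 1# # 0#
  1#0 = invertible⇒# (1# , S.trans (*-identityˡ _) 1-0≈1 , S.trans (*-identityʳ _) 1-0≈1)
    where
    1-0≈1 : 1# - 0# ≈ 1#
    1-0≈1 = S.trans (+-congˡ -0#≈0#) (+-identityʳ 1#)

  1≉0 : ¬ (1# ≈ 0#)
  1≉0 1≈0 = #-irrefl 1≈0 1#0

  ·-φ : ∀ n x → n · x ≈ φ (+ n) * x
  ·-φ zero    x = S.sym (S.trans (*-congʳ φ.0#-homo) (zeroˡ x))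
  ·-φ (suc n) x = begin
    x + n · x                     ≈⟨ +-cong (S.sym (S.trans (*-congʳ φ.1#-homo) (*-identityˡ x))) (·-φ n x) ⟩
    φ (+ 1) * x + φ (+ n) * x     ≈⟨ distribʳ x (φ (+ 1)) (φ (+ n)) ⟨
    (φ (+ 1) + φ (+ n)) * x       ≈⟨ *-congʳ (φ.+-homo (+ 1) (+ n)) ⟨
    φ (+ suc n) * x               ∎

  evalℚ-fromℤ : ∀ f → evalℚ (map fromℤ f) θ ≡ eval θ f
  evalℚ-fromℤ f = foldr-map (λ c t → ι c + θ * t) fromℤ 0# f

  ℤ[θ]-resp : ∀ {x y} → x ≈ y → ℤ[θ] x → ℤ[θ] y
  ℤ[θ]-resp x≈y (h , x≈h) = h , S.trans (S.sym x≈y) x≈h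

  ℤ[θ]-0 : ℤ[θ] 0#
  ℤ[θ]-0 = [] , S.refl

  ℤ[θ]-+ : ∀ {x y} → ℤ[θ] x → ℤ[θ] y → ℤ[θ] (x + y)
  ℤ[θ]-+ (h , x≈h) (h′ , y≈h′) = h +ₚ h′ , S.trans (+-cong x≈h y≈h′) (S.sym (eval-+ θ h h′))

  ℤ[θ]-neg : ∀ {x} → ℤ[θ] x → ℤ[θ] (- x)
  ℤ[θ]-neg {x} (h , x≈h) = map (-[1+ 0 ] ℤ.*_) h , (begin
    - x                             ≈⟨ -‿cong x≈h ⟩
    - eval θ h                      ≈⟨ solve 1 (λ e → :- e := con -[1+ 0 ] :* e) S.refl (eval θ h) ⟩
    φ -[1+ 0 ] * eval θ h           ≈⟨ eval-scale θ -[1+ 0 ] h ⟨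
    eval θ (map (-[1+ 0 ] ℤ.*_) h)  ∎)

  -- Adding w(θ) to u(θ)/v(θ) keeps the denominator and changes the numerator to u + w v. This is
  -- what makes translation by γ act on the cosets in `𝓞`.
  𝓞-+ : ∀ {x} w → Integral (evalℚ w θ) → 𝓞 x → 𝓞 (x + evalℚ w θ)
  𝓞-+ {x} w w-int ((u , v , v#0 , xv≈u) , x-int) =
    (u ℚPoly.+ₚ (w ℚPoly.*ₚ v) , v , v#0 , (begin
      (x + evalℚ w θ) * evalℚ v θ                 ≈⟨ distribʳ _ _ _ ⟩
      x * evalℚ v θ + evalℚ w θ * evalℚ v θ       ≈⟨ +-cong xv≈u (S.sym (ℚEval.eval-* w v)) ⟩
      evalℚ u θ + evalℚ (w ℚPoly.*ₚ v) θ          ≈⟨ ℚEval.eval-+ u (w ℚPoly.*ₚ v) ⟨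
      evalℚ (u ℚPoly.+ₚ (w ℚPoly.*ₚ v)) θ         ∎)) ,
    integral-+ x-int w-int

  constant-no-root : ∀ f → MonicOfDegree 0 f → ¬ (eval θ f ≈ 0#)
  constant-no-root f (lead , deg) f≈0 = 1≉0 (begin
    1#                        ≈⟨ φ.1#-homo ⟨
    φ (+ 1)                   ≈⟨ eval-constant θ (+ 1) ⟨
    eval θ (constant (+ 1))   ≈⟨ eval-cong θ f (constant (+ 1)) (λ { zero → lead ; (suc i) → deg (suc i) (s≤s z≤n) }) ⟨
    eval θ f                  ≈⟨ f≈0 ⟩
    0#                        ∎)

  module _ {d} f (monic : MonicOfDegree (suc d) f) (irreducible : IrreducibleOverℚ f) (fθ≈0 : eval θ f ≈ 0#) where

    -- Independence over ℚ, carried back along the injection of ℤ. Only the coefficient at d is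
    -- kept, since that is where f₁ has its leading 1.
    ℤ-independent : ∀ r → DegreeBelow (suc d) r → eval θ r ≈ 0# → coeff r d ≡ + 0
    ℤ-independent r deg r≈0 = fromℤ-injective (trans (sym (coeff-map-fromℤ r d))
      (powers-independent S ι ι-hom θ 1≉0 (map fromℤ f) ℚ-monic irreducible
        (S.trans (reflexive (evalℚ-fromℤ f)) fθ≈0) (suc d) (map fromℤ r) ℕ.≤-refl
        (λ i d<i → trans (coeff-map-fromℤ r i) (cong fromℤ (deg i d<i)))
        (S.trans (reflexive (evalℚ-fromℤ r)) r≈0) d))
      where
      ℚ-monic : ℚPoly.MonicOfDegree (suc d) (map fromℤ f)
      ℚ-monic = trans (coeff-map-fromℤ f (suc d)) (cong fromℤ (proj₁ monic)) ,
                λ i d<i → trans (coeff-map-fromℤ f i) (cong fromℤ (proj₂ monic i d<i))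

    module _ (p : ℕ) (p-prime : Prime p) (c : ℤ) (a b : ℤ)
      (fc≡ap² : value c f ≡ a ℤ.* + (p ℕ.^ 2)) (f′c≡bp : derivative c f ≡ b ℤ.* + p) where

      private instance
        fromℤ[p]≢0 : ℚ.NonZero (fromℤ (+ p))
        fromℤ[p]≢0 = ℚ.≢-nonZero λ p≡0 →
          ¬prime[0] (subst Prime (ℤ.+-injective (fromℤ-injective {+ p} {+ 0} p≡0)) p-prime)

      f₁ h : Poly
      f₁ = quotient c f
      h  = quotient c f₁

      f₁-monic : MonicOfDegree d f₁
      f₁-monic = quotient-monic c f monic

      1/p : ℚ
      1/p = ℚ.1/ fromℤ (+ p)

      -- The polynomial f₁ / p over ℚ. Having γ as its value at θ puts γ into the form that `𝓞-+`
      -- accepts.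
      w : ℚPoly.Poly
      w = map (1/p ℚ.*_) (map fromℤ f₁)

      γ : Carrier
      γ = evalℚ w θ

      private
        P π F H δ : Carrier
        P = φ (+ p)
        π = ι 1/p
        F = eval θ f₁
        H = eval θ h
        δ = θ - φ c

      πP≈1 : π * P ≈ 1#
      πP≈1 = begin
        π * P                       ≈⟨ ι.*-homo 1/p (fromℤ (+ p)) ⟨
        ι (1/p ℚ.* fromℤ (+ p))     ≡⟨ cong ι (ℚ.*-inverseˡ (fromℤ (+ p))) ⟩
        ι ℚ.1ℚ                      ≈⟨ ι.1#-homo ⟩
        1#                          ∎

      γ≈πF : γ ≈ π * F
      γ≈πF = S.trans (ℚEval.eval-scale 1/p (map fromℤ f₁)) (*-congˡ (reflexive (evalℚ-fromℤ f₁)))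

      Pγ≈F : P * γ ≈ F
      Pγ≈F = begin
        P * γ          ≈⟨ *-congˡ γ≈πF ⟩
        P * (π * F)    ≈⟨ solve 3 (λ p q f → p :* (q :* f) := (q :* p) :* f) S.refl P π F ⟩
        (π * P) * F    ≈⟨ S.trans (*-congʳ πP≈1) (*-identityˡ F) ⟩
        F              ∎

      fθ-expansion : φ a * (P * P) + δ * F ≈ 0#
      fθ-expansion = begin
        φ a * (P * P) + δ * F                 ≈⟨ +-congʳ (*-congˡ (φ.*-homo (+ p) (+ p))) ⟨
        φ a * φ (+ p ℤ.* + p) + δ * F         ≈⟨ +-congʳ (φ.*-homo a (+ p ℤ.* + p)) ⟨
        φ (a ℤ.* (+ p ℤ.* + p)) + δ * F       ≡⟨ cong (λ z → φ z + δ * F) (trans (cong (a ℤ.*_) p*p≡p²) (sym fc≡ap²)) ⟩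
        φ (value c f) + δ * F                 ≈⟨ eval-quotient S φ φ-hom θ c f ⟨
        eval θ f                              ≈⟨ fθ≈0 ⟩
        0#                                    ∎
        where
        p*p≡p² : + p ℤ.* + p ≡ + (p ℕ.^ 2)
        p*p≡p² = trans (sym (ℤ.pos-* p p)) (cong (λ k → + (p ℕ.* k)) (sym (ℕ.*-identityʳ p)))

      F-expansion : F ≈ φ b * P + δ * H
      F-expansion = begin
        F                            ≈⟨ eval-quotient S φ φ-hom θ c f₁ ⟩
        φ (value c f₁) + δ * H       ≡⟨ cong (λ z → φ z + δ * H) f′c≡bp ⟩
        φ (b ℤ.* + p) + δ * H        ≈⟨ +-congʳ (φ.*-homo b (+ p)) ⟩
        φ b * P + δ * H              ∎

      -- One factor f₁(θ) is expanded at c; its product with the other contains (θ - c) f₁(θ) = - a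
      -- p², which cancels the denominator p². The right side is ordered as h₀(θ) + γ h₁(θ), the
      -- shape that `PowersBelow` asks for.
      γ²≈ : γ * γ ≈ φ (ℤ.- a) * H + γ * φ b
      γ²≈ = begin
        γ * γ
          ≈⟨ *-cong γ≈πF (S.trans γ≈πF (*-congˡ F-expansion)) ⟩
        (π * F) * (π * (φ b * P + δ * H))
          -- The first summand is a multiple of the relation f(θ) = 0. What remains is grouped so
          -- that P occurs only in products `π * P`, which are 1.
          ≈⟨ solve 7 (λ q f b p d h a → (q :* f) :* (q :* (b :* p :+ d :* h))
               := (q :* q :* h) :* (a :* (p :* p) :+ d :* f) :+ ((q :* f :* b) :* (q :* p) :- (a :* h) :* ((q :* p) :* (q :* p))))
               S.refl π F (φ b) P δ H (φ a) ⟩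
        (π * π * H) * (φ a * (P * P) + δ * F) + ((π * F * φ b) * (π * P) - (φ a * H) * ((π * P) * (π * P)))
          ≈⟨ +-cong (S.trans (*-congˡ fθ-expansion) (zeroʳ _))
               (+-cong (S.trans (*-congˡ πP≈1) (*-identityʳ _))
                 (-‿cong (S.trans (*-congˡ (S.trans (*-cong πP≈1 πP≈1) (*-identityʳ 1#))) (*-identityʳ _)))) ⟩
        0# + (π * F * φ b - φ a * H)
          ≈⟨ +-identityˡ _ ⟩
        π * F * φ b - φ a * H
          ≈⟨ +-congʳ (*-congʳ γ≈πF) ⟨
        γ * φ b - φ a * H
          ≈⟨ solve 4 (λ g b a h → g :* b :- a :* h := (:- a) :* h :+ g :* b) S.refl γ (φ b) (φ a) H ⟩
        - φ a * H + γ * φ b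
          ≈⟨ +-congʳ (*-congʳ (φ.-‿homo a)) ⟨
        φ (ℤ.- a) * H + γ * φ b ∎

      γ-integral : Integral γ
      γ-integral = integral-trans 2 (f , (suc d , monic) , fθ≈0)
        (cons (map (ℤ.- a ℤ.*_) h) (cons (constant b) (nil S.refl) S.refl) (begin
          γ * (γ * 1#)
            ≈⟨ *-congˡ (*-identityʳ γ) ⟩
          γ * γ
            ≈⟨ γ²≈ ⟩
          φ (ℤ.- a) * H + γ * φ b
            ≈⟨ +-cong (eval-scale θ (ℤ.- a) h) (*-congˡ (S.trans (+-congˡ (zeroʳ γ)) (S.trans (+-identityʳ _) (eval-constant θ b)))) ⟨
          eval θ (map (ℤ.- a ℤ.*_) h) + γ * (eval θ (constant b) + γ * 0#) ∎))

      -- If γ = r(θ) with deg r ≤ d, then p r - f₁ vanishes at θ and has degree at most d. Its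
      -- coefficient at d is p r_d - 1, which must be 0, so p divides 1.
      γ∉ℤ[θ] : ¬ ℤ[θ] γ
      γ∉ℤ[θ] (u , γ≈u) with eval-reduce θ f monic fθ≈0 u
      ... | r , r-deg , u≈r = ¬prime[1] (subst Prime (∣1⇒≡1 (ℤ.∣⇒∣ᵤ p∣1)) p-prime)
        where
        t : Poly
        t = map (+ p ℤ.*_) r -ₚ f₁
        t-deg : DegreeBelow (suc d) t
        t-deg = degreeBelow-+ (map (+ p ℤ.*_) r) (map (-[1+ 0 ] ℤ.*_) f₁)
          (degreeBelow-scale (+ p) r r-deg) (degreeBelow-scale -[1+ 0 ] f₁ (proj₂ f₁-monic))
        t≈0 : eval θ t ≈ 0#
        t≈0 = begin
          eval θ t                                ≈⟨ eval-minus θ (map (+ p ℤ.*_) r) f₁ ⟩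
          eval θ (map (+ p ℤ.*_) r) - F           ≈⟨ +-congʳ (eval-scale θ (+ p) r) ⟩
          P * eval θ r - F                        ≈⟨ +-congʳ (*-congˡ (S.trans γ≈u u≈r)) ⟨
          P * γ - F                               ≈⟨ +-congʳ Pγ≈F ⟩
          F - F                                   ≈⟨ -‿inverseʳ F ⟩
          0#                                      ∎
        top : + p ℤ.* coeff r d ℤ.- + 1 ≡ + 0
        top = trans (sym (trans (coeff-+ (map (+ p ℤ.*_) r) (map (-[1+ 0 ] ℤ.*_) f₁) d)
          (cong₂ ℤ._+_ (coeff-scale (+ p) r d) (trans (coeff-scale -[1+ 0 ] f₁ d) (cong (-[1+ 0 ] ℤ.*_) (proj₁ f₁-monic))))))
          (ℤ-independent t t-deg t≈0)
        p∣1 : + p ℤ.∣ + 1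
        p∣1 = ℤ.divides (coeff r d) (trans (sym (ℤ.i-j≡0⇒i≡j _ _ top)) (ℤ.*-comm (+ p) (coeff r d)))

      -- If p did not divide n, the two would be coprime, and p γ = f₁(θ) and n γ in ℤ[θ] would give
      -- γ in ℤ[θ]. Divisibility in ℕ is decidable, so this contradiction is enough.
      p∣index : ∀ n → IndexIs n → p ∣ n
      p∣index n index = decidable-stable (p ∣? n) λ p∤n →
        γ∉ℤ[θ] (·-coprime ℤ[θ]-resp ℤ[θ]-0 ℤ[θ]-+ ℤ[θ]-neg (coprime p∤n)
          (ℤ[θ]-resp (S.sym (S.trans (·-φ p γ) Pγ≈F)) (f₁ , S.refl))
          (index-· ℤ[θ]-resp ℤ[θ]-0 ℤ[θ]-+ ℤ[θ]-neg index (𝓞-+ w γ-integral)))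
        where
        open CosetCounting L ι θ {𝓞} {ℤ[θ]}
        coprime : ¬ p ∣ n → Coprime p n
        coprime p∤n (d∣p , d∣n) with prime⇒irreducible p-prime d∣p
        ... | inj₁ d≡1 = d≡1
        ... | inj₂ refl = contradiction d∣n p∤n

theorem6p7 : ∀ {a ℓ₁ ℓ₂} (L : HeytingField a ℓ₁ ℓ₂) (ι : ℚ → HeytingField.Carrier L) →
    IsRingHomomorphism +-*-rawRing (fieldRing L) ι →
    (θ : HeytingField.Carrier L) →
    (p : ℕ) → Prime p →
    (g : ℤ[X].Poly) → ℤ[X].Monic g →
    IrreducibleOverℚ (substPower p g) →
    Adjoin.IsRootOf L ι θ (substPower p g) →
    (∃[ c ] VanishesAtω p g (+ (toℕ {p} c))) →
    (∀ n → Adjoin.IndexIs L ι θ n → p ∣ n) × ¬ (Adjoin.Monogenic L ι θ)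
theorem6p7 L ι ι-hom θ zero p-prime = contradiction p-prime ¬prime[0]
-- For g of degree 0 the polynomial f is the constant 1, which has no root. Otherwise deg f is
-- positive, as the division by X - c requires.
theorem6p7 L ι ι-hom θ p@(suc n) p-prime g (zero , g-monic) irreducible root _ =
  contradiction root (PowerSubstitutionRoot.constant-no-root L ι ι-hom θ (substPower p g) (substPower-monic n g g-monic))
theorem6p7 L ι ι-hom θ p@(suc n) p-prime g (suc e , g-monic) irreducible root (c , ℤ.divides a gω-0≡ap²)
  with derivative-substPower (+ toℕ c) n g
... | ℤ.divides b f′c≡bp = p∣index , λ index → ¬prime[1] (subst Prime (∣1⇒≡1 (p∣index 1 index)) p-prime)
  where
  f = substPower p g
  fc≡ap² : value (+ toℕ c) f ≡ a ℤ.* + (p ℕ.^ 2)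
  -- Vanishing in ℤ/p² is divisibility of the difference with 0, and that 0 is removed here.
  fc≡ap² = trans (value-substPower (+ toℕ c) p g) (trans (sym (ℤ.+-identityʳ _)) gω-0≡ap²)
  p∣index = PowerSubstitutionRoot.p∣index L ι ι-hom θ f (substPower-monic n g g-monic) irreducible root p p-prime (+ toℕ c) a b fc≡ap² f′c≡bp
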